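{- Let $k$ be a field. Let $(A_i)_{i\in I}$ be a filtered system of quadratic graded $k$-algebras with injective transition maps (graded $k$-algebra homomorphisms), such that each $A_i$ is of finite type and universally Koszul. Then $A:=\varinjlim_{i\in I}A_i$ is asymptotically universally Koszul.
   Context: A graded $k$-algebra $A=\bigoplus_{n\ge 0}A_n$ is connected if $A_0=k$. A connected graded $k$-algebra generated in degree $1$ is quadratic if $A\cong T(V)/\langle R\rangle$ as graded algebras, where $V=A_1$ (possibly infinite-dimensional) and $R\subseteq V\otimes_k V$ is a subspace. A quadratic algebra $A$ is of finite type if $\dim_k A_1<\infty$. Universal Koszulity: let $A$ be a quadratic algebra with $\dim_k A_1<\infty$. Let $\mathcal L(A)$ be the set of graded left ideals $I\subseteq A$ with $I=A I_1$ (generated in degree $1$). $A$ is universally Koszul if for every $I\in\mathcal L(A)$ and every $x\in A_1\setminus I_1$, the colon ideal $I:x=\{a\in A\mid ax\in I\}$ belongs to $\mathcal L(A)$. Asymptotic universal Koszulity: a connected graded $k$-algebra $A$ generated in degree $1$ is asymptotically universally Koszul if there exists a filtered system (under inclusion) of quadratic graded subalgebras $(A_i)_{i\in I}$ of $A$ such that (i) each $A_i$ is generated in degree $1$ with $\dim_k(A_i)_1<\infty$; (ii) each $A_i$ is universally Koszul; (iii) the natural map $\varinjlim_{i\in I}A_i\to A$ is an isomorphism of graded algebras; (iv) every finite-dimensional subspace of $A_1$ is contained in some $(A_i)_1$. -}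

module Defs where

open import Level using (Lift) renaming (suc to lsuc)
open import Algebra.Apartness.Bundles using (HeytingCommutativeRing; HeytingField)
open import Algebra.Bundles using (AbelianGroup; CommutativeRing; Ring)
open import Algebra.Core using (Op₁; Op₂)
open import Algebra.Module.Bundles using (LeftModule)
open import Algebra.Module.Structures using (IsLeftModule)
open import Algebra.Morphism.Structures using (module RingMorphisms)
open import Algebra.Structures using (IsRing; IsAbelianGroup)
import Algebra.Properties.AbelianGroup as AbelianGroupProperties
import Algebra.Properties.CommutativeMonoid.Sum as Summation
open import Data.Empty using (⊥-elim)
open import Data.Fin.Base using (Fin; zero; suc; toℕ; fromℕ<)
open import Data.Fin.Properties using (toℕ-injective; toℕ-fromℕ<; toℕ<n)
open import Data.List.Base using (List; []; _∷_; _++_; length)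
open import Data.List.Properties using (++-assoc; ++-identityʳ; length-++)
open import Data.Nat.Base as ℕ using (ℕ; zero; suc; _≤_; _<_; z≤n; s≤s; _⊔_)
open import Data.Nat.Properties as ℕₚ using (m≤m⊔n; m≤n⊔m; ≤-trans; ≤-refl; _≟_)
open import Data.Product.Base using (Σ; Σ-syntax; ∃; ∃-syntax; _×_; _,_; proj₁; proj₂)
open import Data.Unit.Base using (⊤; tt)
open import Data.Vec.Functional using (Vector)
open import Function.Base using (_∘_)
open import Function.Definitions using (Injective)
open import Relation.Binary.Core using (Rel)
open import Relation.Binary.PropositionalEquality as ≡ using (_≡_; _≢_)
open import Relation.Binary.Structures using (IsEquivalence)
open import Relation.Nullary using (¬_; yes; no)
open import Relation.Unary using (Pred; _∈_; _∉_; _⊆_; _∩_)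

-- A directed preorder is the special case in which any two parallel
-- arrows are identified by _≃_.
record FilteredCategory ℓ : Set (lsuc ℓ) where
  infix  4 _⇒_ _≃_
  infixr 9 _⊚_
  field
    Obj  : Set ℓ
    _⇒_  : Rel Obj ℓ
    _≃_  : ∀ {i j} → Rel (i ⇒ j) ℓ
    id   : ∀ {i} → i ⇒ i
    _⊚_  : ∀ {i j m} → j ⇒ m → i ⇒ j → i ⇒ m

    ≃-isEquivalence : ∀ {i j} → IsEquivalence (_≃_ {i} {j})
    ⊚-cong     : ∀ {i j m} {g g′ : j ⇒ m} {f f′ : i ⇒ j} →
                 g ≃ g′ → f ≃ f′ → (g ⊚ f) ≃ (g′ ⊚ f′)
    ⊚-assoc    : ∀ {i j m n} (h : m ⇒ n) (g : j ⇒ m) (f : i ⇒ j) →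
                 ((h ⊚ g) ⊚ f) ≃ (h ⊚ (g ⊚ f))
    identityˡ  : ∀ {i j} (f : i ⇒ j) → (id ⊚ f) ≃ f
    identityʳ  : ∀ {i j} (f : i ⇒ j) → (f ⊚ id) ≃ f

    inhabited  : Obj
    upperBound : ∀ i j → ∃[ m ] (i ⇒ m) × (j ⇒ m)
    coequalize : ∀ {i j} (f g : i ⇒ j) → ∃[ m ] Σ[ h ∈ (j ⇒ m) ] (h ⊚ f) ≃ (h ⊚ g)

-- Classically every field is a Heyting field, with _#_ the negation of _≈_.
-- Scalars, vector spaces and algebras all live in one arbitrary universe.
module _ {ℓ} (k : HeytingField ℓ ℓ ℓ) where

  module K = CommutativeRing
    (HeytingCommutativeRing.commutativeRing (HeytingField.heytingCommutativeRing k))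

  VectorSpace : Set (lsuc ℓ)
  VectorSpace = LeftModule K.ring ℓ ℓ

  record IsSubspace (V : VectorSpace) (P : Pred (LeftModule.Carrierᴹ V) ℓ) : Set ℓ where
    open LeftModule V
    field
      resp : ∀ {x y} → x ≈ᴹ y → P x → P y
      0∈   : P 0ᴹ
      +∈   : ∀ {x y} → P x → P y → P (x +ᴹ y)
      ·∈   : ∀ r {x} → P x → P (r *ₗ x)

  data Span (V : VectorSpace) (P : Pred (LeftModule.Carrierᴹ V) ℓ) :
            Pred (LeftModule.Carrierᴹ V) ℓ where
    base : ∀ {x} → P x → Span V P x
    zer  : Span V P (LeftModule.0ᴹ V)
    add  : ∀ {x y} → Span V P x → Span V P y → Span V P (LeftModule._+ᴹ_ V x y)
    scal : ∀ r {x} → Span V P x → Span V P (LeftModule._*ₗ_ V r x)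
    resp : ∀ {x y} → LeftModule._≈ᴹ_ V x y → Span V P x → Span V P y

  module _ (V : VectorSpace) where
    open LeftModule V
    open Summation +ᴹ-commutativeMonoid using (sum)

    linearCombination : ∀ {n} → Vector K.Carrier n → Vector Carrierᴹ n → Carrierᴹ
    linearCombination r b = sum (λ i → r i *ₗ b i)

    IsBasis : ∀ {n} → Vector Carrierᴹ n → Set ℓ
    IsBasis b = (∀ v → ∃[ r ] v ≈ᴹ linearCombination r b)
              × (∀ r → linearCombination r b ≈ᴹ 0ᴹ → ∀ i → r i K.≈ K.0#)

    FiniteDimensional : Set ℓ
    FiniteDimensional = ∃[ n ] Σ[ b ∈ Vector Carrierᴹ n ] IsBasis b

  module VectorSpaceLemmas (V : VectorSpace) where
    open LeftModule V public
    open AbelianGroupProperties +ᴹ-abelianGroup public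
      using (inverseˡ-unique; inverseʳ-unique; identityˡ-unique; identityʳ-unique)
    open Summation +ᴹ-commutativeMonoid public using (sum; sum-cong-≋; ∑-distrib-+)

    interchange : ∀ a b c d → (a +ᴹ b) +ᴹ (c +ᴹ d) ≈ᴹ (a +ᴹ c) +ᴹ (b +ᴹ d)
    interchange a b c d =
      ≈ᴹ-trans (+ᴹ-assoc a b _) (≈ᴹ-trans (+ᴹ-cong ≈ᴹ-refl
        (≈ᴹ-trans (≈ᴹ-sym (+ᴹ-assoc b c d)) (≈ᴹ-trans (+ᴹ-cong (+ᴹ-comm b c) ≈ᴹ-refl)
          (+ᴹ-assoc c b d)))) (≈ᴹ-sym (+ᴹ-assoc a c _)))

    neg≈ : ∀ x → (K.- K.1#) *ₗ x ≈ᴹ -ᴹ x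
    neg≈ x = inverseˡ-unique _ x
      (≈ᴹ-trans (+ᴹ-cong ≈ᴹ-refl (≈ᴹ-sym (*ₗ-identityˡ x)))
      (≈ᴹ-trans (≈ᴹ-sym (*ₗ-distribʳ x _ _))
      (≈ᴹ-trans (*ₗ-cong (K.-‿inverseˡ K.1#) ≈ᴹ-refl) (*ₗ-zeroˡ x))))

    x-y≈0⇒x≈y : ∀ {x y} → x +ᴹ -ᴹ y ≈ᴹ 0ᴹ → x ≈ᴹ y
    x-y≈0⇒x≈y {x} {y} p = ≈ᴹ-trans (inverseˡ-unique x (-ᴹ y) p)
      (≈ᴹ-sym (inverseʳ-unique (-ᴹ y) y (-ᴹ‿inverseˡ y)))

    x≈y⇒x-y≈0 : ∀ {x y} → x ≈ᴹ y → x +ᴹ -ᴹ y ≈ᴹ 0ᴹ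
    x≈y⇒x-y≈0 {x} {y} p = ≈ᴹ-trans (+ᴹ-cong p ≈ᴹ-refl) (-ᴹ‿inverseʳ y)

    sum≈0 : ∀ {n} (f : Vector Carrierᴹ n) → (∀ i → f i ≈ᴹ 0ᴹ) → sum f ≈ᴹ 0ᴹ
    sum≈0 {zero}  f z = ≈ᴹ-refl
    sum≈0 {suc n} f z = ≈ᴹ-trans (+ᴹ-cong (z zero) (sum≈0 (f ∘ suc) (z ∘ suc))) (+ᴹ-identityˡ 0ᴹ)

    sum-δ : ∀ {n} (f : Vector Carrierᴹ n) i → (∀ j → j ≢ i → f j ≈ᴹ 0ᴹ) → sum f ≈ᴹ f i
    sum-δ f zero z = ≈ᴹ-trans (+ᴹ-cong ≈ᴹ-refl (sum≈0 (f ∘ suc) λ j → z (suc j) λ ())) (+ᴹ-identityʳ _)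
    sum-δ f (suc i) z = ≈ᴹ-trans (+ᴹ-cong (z zero λ ())
      (sum-δ (f ∘ suc) i λ j j≢i → z (suc j) λ { ≡.refl → j≢i ≡.refl })) (+ᴹ-identityˡ _)

    sum-· : ∀ r {n} (f : Vector Carrierᴹ n) → r *ₗ sum f ≈ᴹ sum (λ i → r *ₗ f i)
    sum-· r {zero}  f = *ₗ-zeroʳ r
    sum-· r {suc n} f = ≈ᴹ-trans (*ₗ-distribˡ r _ _) (+ᴹ-cong ≈ᴹ-refl (sum-· r (f ∘ suc)))

    Span-isSubspace : ∀ P → IsSubspace V (Span V P)
    Span-isSubspace P = record { resp = resp ; 0∈ = zer ; +∈ = add ; ·∈ = scal }

    Span-least : ∀ {P Q} → IsSubspace V Q → P ⊆ Q → Span V P ⊆ Q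
    Span-least Q P⊆Q (base p)   = P⊆Q p
    Span-least Q P⊆Q zer        = IsSubspace.0∈ Q
    Span-least Q P⊆Q (add p q)  = IsSubspace.+∈ Q (Span-least Q P⊆Q p) (Span-least Q P⊆Q q)
    Span-least Q P⊆Q (scal r p) = IsSubspace.·∈ Q r (Span-least Q P⊆Q p)
    Span-least Q P⊆Q (resp e p) = IsSubspace.resp Q e (Span-least Q P⊆Q p)

    module _ {P} (isSub : IsSubspace V P) where
      private module S = IsSubspace isSub

      neg∈ : ∀ {x} → P x → P (-ᴹ x)
      neg∈ p = S.resp (neg≈ _) (S.·∈ _ p)

      sum∈ : ∀ {n} (f : Vector Carrierᴹ n) → (∀ i → P (f i)) → P (sum f)
      sum∈ {zero}  f p = S.0∈
      sum∈ {suc n} f p = S.+∈ (p zero) (sum∈ (f ∘ suc) (p ∘ suc))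

  subspace : (V : VectorSpace) {P : Pred (LeftModule.Carrierᴹ V) ℓ} → IsSubspace V P → VectorSpace
  subspace V {P} isSub = record
    { Carrierᴹ = ∃ P
    ; _≈ᴹ_ = λ x y → proj₁ x ≈ᴹ proj₁ y
    ; _+ᴹ_ = λ x y → proj₁ x +ᴹ proj₁ y , +∈ (proj₂ x) (proj₂ y)
    ; _*ₗ_ = λ r x → r *ₗ proj₁ x , ·∈ r (proj₂ x)
    ; 0ᴹ = 0ᴹ , 0∈
    ; -ᴹ_ = λ x → -ᴹ proj₁ x , neg∈ isSub (proj₂ x)
    ; isLeftModule = record
      { isLeftSemimodule = record
        { +ᴹ-isCommutativeMonoid = record
          { isMonoid = record
            { isSemigroup = record
              { isMagma = record
                { isEquivalence = record { refl = ≈ᴹ-refl ; sym = ≈ᴹ-sym ; trans = ≈ᴹ-trans }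
                ; ∙-cong = +ᴹ-cong }
              ; assoc = λ x y z → +ᴹ-assoc _ _ _ }
            ; identity = (λ x → +ᴹ-identityˡ _) , (λ x → +ᴹ-identityʳ _) }
          ; comm = λ x y → +ᴹ-comm _ _ }
        ; isPreleftSemimodule = record
          { *ₗ-cong = *ₗ-cong
          ; *ₗ-zeroˡ = λ x → *ₗ-zeroˡ _
          ; *ₗ-distribʳ = λ x r s → *ₗ-distribʳ _ r s
          ; *ₗ-identityˡ = λ x → *ₗ-identityˡ _
          ; *ₗ-assoc = λ r s x → *ₗ-assoc r s _
          ; *ₗ-zeroʳ = *ₗ-zeroʳ
          ; *ₗ-distribˡ = λ r x y → *ₗ-distribˡ r _ _ } }
      ; -ᴹ‿cong = -ᴹ‿cong
      ; -ᴹ‿inverse = (λ x → -ᴹ‿inverseˡ _) , (λ x → -ᴹ‿inverseʳ _) } }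
    where
    open VectorSpaceLemmas V
    open IsSubspace isSub using (0∈; +∈; ·∈)

  record Algebra : Set (lsuc ℓ) where
    infix  8 -_
    infixr 7 _·_
    infixl 7 _*_
    infixl 6 _+_
    infix  4 _≈_
    field
      Carrier : Set ℓ
      _≈_     : Rel Carrier ℓ
      _+_ _*_ : Op₂ Carrier
      -_      : Op₁ Carrier
      0# 1#   : Carrier
      _·_     : K.Carrier → Carrier → Carrier
      isRing       : IsRing _≈_ _+_ _*_ -_ 0# 1#
      isLeftModule : IsLeftModule K.ring _≈_ _+_ 0# -_ _·_
      ·-*-assocˡ   : ∀ r a b → (r · a) * b ≈ r · (a * b)
      ·-*-assocʳ   : ∀ r a b → a * (r · b) ≈ r · (a * b)

    ring : Ring ℓ ℓ
    ring = record { isRing = isRing }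

    vectorSpace : VectorSpace
    vectorSpace = record { isLeftModule = isLeftModule }

    open Ring ring public using
      ( refl; sym; trans; reflexive; setoid; isEquivalence; rawRing
      ; +-cong; +-assoc; +-comm; +-identityˡ; +-identityʳ; -‿cong; -‿inverseˡ; -‿inverseʳ
      ; *-cong; *-assoc; *-identityˡ; *-identityʳ; distribˡ; distribʳ; zeroˡ; zeroʳ )
    open LeftModule vectorSpace public using () renaming
      ( *ₗ-cong to ·-cong; *ₗ-distribˡ to ·-distribˡ; *ₗ-distribʳ to ·-distribʳ
      ; *ₗ-assoc to ·-assoc; *ₗ-identityˡ to ·-identityˡ; *ₗ-zeroˡ to ·-zeroˡ; *ₗ-zeroʳ to ·-zeroʳ )
    open Summation (LeftModule.+ᴹ-commutativeMonoid vectorSpace) public using (sum)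

  -- A non-redundant list of laws from which an Algebra is assembled.
  record AlgebraLaws : Set (lsuc ℓ) where
    infix  8 -_
    infixr 7 _·_
    infixl 7 _*_
    infixl 6 _+_
    infix  4 _≈_
    field
      Carrier : Set ℓ
      _≈_     : Rel Carrier ℓ
      _+_ _*_ : Op₂ Carrier
      -_      : Op₁ Carrier
      0# 1#   : Carrier
      _·_     : K.Carrier → Carrier → Carrier
      isEquivalence : IsEquivalence _≈_
      +-cong      : ∀ {a a′ b b′} → a ≈ a′ → b ≈ b′ → a + b ≈ a′ + b′
      +-assoc     : ∀ a b c → (a + b) + c ≈ a + (b + c)
      +-comm      : ∀ a b → a + b ≈ b + a
      +-identityˡ : ∀ a → 0# + a ≈ a
      -‿cong      : ∀ {a a′} → a ≈ a′ → - a ≈ - a′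
      -‿inverseˡ  : ∀ a → - a + a ≈ 0#
      *-cong      : ∀ {a a′ b b′} → a ≈ a′ → b ≈ b′ → a * b ≈ a′ * b′
      *-assoc     : ∀ a b c → (a * b) * c ≈ a * (b * c)
      *-identityˡ : ∀ a → 1# * a ≈ a
      *-identityʳ : ∀ a → a * 1# ≈ a
      distribˡ    : ∀ a b c → a * (b + c) ≈ a * b + a * c
      distribʳ    : ∀ a b c → (b + c) * a ≈ b * a + c * a
      ·-cong      : ∀ {r s a b} → r K.≈ s → a ≈ b → r · a ≈ s · b
      ·-distribˡ  : ∀ r a b → r · (a + b) ≈ r · a + r · b
      ·-distribʳ  : ∀ a r s → (r K.+ s) · a ≈ r · a + s · a
      ·-assoc     : ∀ r s a → (r K.* s) · a ≈ r · (s · a)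
      ·-identityˡ : ∀ a → K.1# · a ≈ a
      ·-*-assocˡ  : ∀ r a b → (r · a) * b ≈ r · (a * b)
      ·-*-assocʳ  : ∀ r a b → a * (r · b) ≈ r · (a * b)

    open IsEquivalence isEquivalence public

    +-isAbelianGroup : IsAbelianGroup _≈_ _+_ 0# -_
    +-isAbelianGroup = record
      { isGroup = record
        { isMonoid = record
          { isSemigroup = record
            { isMagma = record { isEquivalence = isEquivalence ; ∙-cong = +-cong }
            ; assoc = +-assoc }
          ; identity = +-identityˡ , λ a → trans (+-comm a 0#) (+-identityˡ a) }
        ; inverse = -‿inverseˡ , λ a → trans (+-comm a (- a)) (-‿inverseˡ a)
        ; ⁻¹-cong = -‿cong }
      ; comm = +-comm }

    +-abelianGroup : AbelianGroup ℓ ℓ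
    +-abelianGroup = record { isAbelianGroup = +-isAbelianGroup }

    private module G = AbelianGroupProperties +-abelianGroup

    algebra : Algebra
    algebra = record
      { isRing = record
        { +-isAbelianGroup = +-isAbelianGroup
        ; *-cong = *-cong
        ; *-assoc = *-assoc
        ; *-identity = *-identityˡ , *-identityʳ
        ; distrib = distribˡ , distribʳ }
      ; isLeftModule = record
        { isLeftSemimodule = record
          { +ᴹ-isCommutativeMonoid = IsAbelianGroup.isCommutativeMonoid +-isAbelianGroup
          ; isPreleftSemimodule = record
            { *ₗ-cong = ·-cong
            ; *ₗ-zeroˡ = λ a → G.identityˡ-unique _ _
                (trans (sym (·-distribʳ a _ _)) (·-cong (K.+-identityˡ K.0#) refl))
            ; *ₗ-distribʳ = ·-distribʳ
            ; *ₗ-identityˡ = ·-identityˡ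
            ; *ₗ-assoc = ·-assoc
            ; *ₗ-zeroʳ = λ r → G.identityˡ-unique _ _
                (trans (sym (·-distribˡ r _ _)) (·-cong K.refl (+-identityˡ 0#)))
            ; *ₗ-distribˡ = ·-distribˡ } }
        ; -ᴹ‿cong = -‿cong
        ; -ᴹ‿inverse = IsAbelianGroup.inverse +-isAbelianGroup }
      ; ·-*-assocˡ = ·-*-assocˡ
      ; ·-*-assocʳ = ·-*-assocʳ }

  -- Graded algebras: the carrier is the total space A = ⊕ₙ Aₙ, an
  -- internal direct sum, and Deg n is the subspace Aₙ.

  record GradedAlgebra : Set (lsuc ℓ) where
    field
      algebra : Algebra
    open Algebra algebra public
    field
      Deg            : ℕ → Pred Carrier ℓ
      Deg-isSubspace : ∀ n → IsSubspace vectorSpace (Deg n)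
      1∈Deg          : 1# ∈ Deg 0
      *∈Deg          : ∀ {m n a b} → a ∈ Deg m → b ∈ Deg n → a * b ∈ Deg (m ℕ.+ n)

    Homogeneous : Pred Carrier ℓ
    Homogeneous a = ∃[ n ] a ∈ Deg n

    -- Every element is a sum of homogeneous ones, and the sum of the Aₙ is direct.
    field
      spanning    : ∀ a → a ∈ Span vectorSpace Homogeneous
      independent : ∀ {n} (f : Vector Carrier n) → (∀ i → f i ∈ Deg (toℕ i)) →
                    sum f ≈ 0# → ∀ i → f i ≈ 0#

    degree : ℕ → VectorSpace
    degree n = subspace vectorSpace (Deg-isSubspace n)

  module _ (A B : GradedAlgebra) where
    private
      module A = GradedAlgebra A
      module B = GradedAlgebra B

    record GradedHom : Set ℓ where
      open RingMorphisms A.rawRing B.rawRing using (IsRingHomomorphism)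
      field
        ⟦_⟧                : A.Carrier → B.Carrier
        isRingHomomorphism : IsRingHomomorphism ⟦_⟧
        ·-homo             : ∀ r a → ⟦ r A.· a ⟧ B.≈ r B.· ⟦ a ⟧
        Deg-homo           : ∀ {n a} → a ∈ A.Deg n → ⟦ a ⟧ ∈ B.Deg n
      open IsRingHomomorphism isRingHomomorphism public
        using (⟦⟧-cong; +-homo; *-homo; -‿homo; 0#-homo; 1#-homo)

  IsIsomorphism : ∀ {A B} → GradedHom A B → Set ℓ
  IsIsomorphism {A} {B} φ = Σ[ ψ ∈ GradedHom B A ]
      (∀ a → GradedAlgebra._≈_ A (GradedHom.⟦_⟧ ψ (GradedHom.⟦_⟧ φ a)) a)
    × (∀ b → GradedAlgebra._≈_ B (GradedHom.⟦_⟧ φ (GradedHom.⟦_⟧ ψ b)) b)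

  _≅_ : GradedAlgebra → GradedAlgebra → Set ℓ
  A ≅ B = ∃ (IsIsomorphism {A} {B})

  module _ (A B : GradedAlgebra) where
    private
      module A = GradedAlgebra A
      module B = GradedAlgebra B

    record GradedHomLaws : Set ℓ where
      field
        fun   : A.Carrier → B.Carrier
        cong  : ∀ {a a′} → a A.≈ a′ → fun a B.≈ fun a′
        plus  : ∀ a b → fun (a A.+ b) B.≈ fun a B.+ fun b
        times : ∀ a b → fun (a A.* b) B.≈ fun a B.* fun b
        one   : fun A.1# B.≈ B.1#
        scale : ∀ r a → fun (r A.· a) B.≈ r B.· fun a
        deg   : ∀ {n a} → a ∈ A.Deg n → fun a ∈ B.Deg n

      private
        module BV = VectorSpaceLemmas B.vectorSpace

        zero≈ : fun A.0# B.≈ B.0#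
        zero≈ = BV.identityˡ-unique (fun A.0#) (fun A.0#)
          (B.trans (B.sym (plus _ _)) (cong (A.+-identityˡ _)))

      hom : GradedHom A B
      hom = record
        { ⟦_⟧ = fun
        ; isRingHomomorphism = record
          { isSemiringHomomorphism = record
            { isNearSemiringHomomorphism = record
              { +-isMonoidHomomorphism = record
                { isMagmaHomomorphism = record
                  { isRelHomomorphism = record { cong = cong } ; homo = plus }
                ; ε-homo = zero≈ }
              ; *-homo = times }
            ; 1#-homo = one }
          ; -‿homo = λ a → BV.inverseˡ-unique _ _
              (B.trans (B.sym (plus _ _)) (B.trans (cong (A.-‿inverseˡ a)) zero≈)) }
        ; ·-homo = scale
        ; Deg-homo = deg }

  module _ (A : GradedAlgebra) where
    open GradedAlgebra A

    record IsHomogeneousIdeal (J : Pred Carrier ℓ) : Set ℓ where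
      field
        isSubspace  : IsSubspace vectorSpace J
        *-closedˡ   : ∀ a {x} → x ∈ J → a * x ∈ J
        *-closedʳ   : ∀ a {x} → x ∈ J → x * a ∈ J
        homogeneous : ∀ {a} → a ∈ J → a ∈ Span vectorSpace (Homogeneous ∩ J)

    data ⟨_⟩ (R : Pred Carrier ℓ) : Pred Carrier ℓ where
      incl : ∀ {a} → R a → ⟨ R ⟩ a
      zer  : ⟨ R ⟩ 0#
      add  : ∀ {a b} → ⟨ R ⟩ a → ⟨ R ⟩ b → ⟨ R ⟩ (a + b)
      mulˡ : ∀ a {x} → ⟨ R ⟩ x → ⟨ R ⟩ (a * x)
      mulʳ : ∀ a {x} → ⟨ R ⟩ x → ⟨ R ⟩ (x * a)
      resp : ∀ {a b} → a ≈ b → ⟨ R ⟩ a → ⟨ R ⟩ b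

  module GradedLemmas (A : GradedAlgebra) where
    open GradedAlgebra A public
    open VectorSpaceLemmas vectorSpace public
      using (sum≈0; sum-δ; sum-·; sum-cong-≋; ∑-distrib-+; x-y≈0⇒x≈y; x≈y⇒x-y≈0; neg∈; sum∈
            ; Span-isSubspace; Span-least; interchange; neg≈; inverseˡ-unique)
    module DegS n = IsSubspace (Deg-isSubspace n)

    ·1* : ∀ r a → (r · 1#) * a ≈ r · a
    ·1* r a = trans (·-*-assocˡ r _ a) (·-cong K.refl (*-identityˡ a))

    Σ< : ℕ → (ℕ → Carrier) → Carrier
    Σ< n g = sum {n} (g ∘ toℕ)

    Σ<-pad : ∀ {m n} (g : ℕ → Carrier) → (∀ i → m ≤ i → g i ≈ 0#) → m ≤ n → Σ< m g ≈ Σ< n g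
    Σ<-pad {zero}  {n} g z m≤n = sym (sum≈0 {n} _ λ i → z _ z≤n)
    Σ<-pad {suc m} {suc n} g z (s≤s m≤n) =
      +-cong refl (Σ<-pad {m} {n} (g ∘ suc) (λ i p → z (suc i) (s≤s p)) m≤n)

    Σ<-δ : ∀ {n} (g : ℕ → Carrier) d → d < n → (∀ i → i ≢ d → g i ≈ 0#) → Σ< n g ≈ g d
    Σ<-δ {suc n} g zero p z = trans (+-cong refl (sum≈0 {n} _ λ i → z _ λ ())) (LeftModule.+ᴹ-identityʳ vectorSpace _)
    Σ<-δ {suc n} g (suc d) (s≤s p) z = trans (+-cong (z 0 λ ())
      (Σ<-δ {n} (g ∘ suc) d p λ i i≢d → z (suc i) λ { ≡.refl → i≢d ≡.refl })) (+-identityˡ _)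

    δ : Carrier → ℕ → ℕ → Carrier
    δ a d n with n ≟ d
    ... | yes _ = a
    ... | no  _ = 0#

    δ-≡ : ∀ a d → δ a d d ≈ a
    δ-≡ a d with d ≟ d
    ... | yes _ = refl
    ... | no ¬p = ⊥-elim (¬p ≡.refl)

    δ-≢ : ∀ a d n → n ≢ d → δ a d n ≈ 0#
    δ-≢ a d n n≢d with n ≟ d
    ... | yes p = ⊥-elim (n≢d p)
    ... | no  _ = refl

    δ-P : (P : ℕ → Pred Carrier ℓ) → (∀ n → P n 0#) → ∀ a d → P d a → ∀ n → P n (δ a d n)
    δ-P P P0 a d Pa n with n ≟ d
    ... | yes ≡.refl = Pa
    ... | no  _      = P0 n

    -- Collecting a sum of homogeneous elements of J by degree.
    module _ {J : Pred Carrier ℓ} (Jsub : IsSubspace vectorSpace J) where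
      private module J = IsSubspace Jsub

      Components : Carrier → Set ℓ
      Components a = ∃[ n ] Σ[ g ∈ (ℕ → Carrier) ]
        (∀ i → g i ∈ Deg i ∩ J) × (∀ i → n ≤ i → g i ≈ 0#) × a ≈ Σ< n g

      collect : ∀ {a} → a ∈ Span vectorSpace (Homogeneous ∩ J) → Components a
      collect (base {a} ((d , a∈d) , a∈J)) = suc d , δ a d
        , (λ n → δ-P (λ n → Deg n ∩ J) (λ n → DegS.0∈ n , J.0∈) a d (a∈d , a∈J) n)
        , (λ i d<i → δ-≢ a d i λ { ≡.refl → ℕₚ.<-irrefl ≡.refl d<i })
        , sym (trans (Σ<-δ {suc d} (δ a d) d ≤-refl (δ-≢ a d)) (δ-≡ a d))
      collect zer = 0 , (λ _ → 0#) , (λ i → DegS.0∈ i , J.0∈) , (λ _ _ → refl) , refl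
      collect (add p q) with collect p | collect q
      ... | m , g , g∈ , gz , eg | n , h , h∈ , hz , eh =
        m ⊔ n , (λ i → g i + h i)
        , (λ i → DegS.+∈ i (proj₁ (g∈ i)) (proj₁ (h∈ i)) , J.+∈ (proj₂ (g∈ i)) (proj₂ (h∈ i)))
        , (λ i le → trans (+-cong (gz i (≤-trans (m≤m⊔n m n) le)) (hz i (≤-trans (m≤n⊔m m n) le)))
                          (+-identityˡ 0#))
        , trans (+-cong (trans eg (Σ<-pad g gz (m≤m⊔n m n))) (trans eh (Σ<-pad h hz (m≤n⊔m m n))))
                (sym (∑-distrib-+ {m ⊔ n} _ _))
      collect (scal r p) with collect p
      ... | m , g , g∈ , gz , eg = m , (λ i → r · g i)
        , (λ i → DegS.·∈ i r (proj₁ (g∈ i)) , J.·∈ r (proj₂ (g∈ i)))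
        , (λ i le → trans (·-cong K.refl (gz i le)) (·-zeroʳ r))
        , trans (·-cong K.refl eg) (sum-· r {m} _)
      collect (resp e p) with collect p
      ... | m , g , g∈ , gz , eg = m , g , g∈ , gz , trans (sym e) eg

    extend : ∀ {n} → Vector Carrier n → ℕ → Carrier
    extend {zero}  f _       = 0#
    extend {suc n} f zero    = f zero
    extend {suc n} f (suc i) = extend (f ∘ suc) i

    extend-toℕ : ∀ {n} (f : Vector Carrier n) i → extend f (toℕ i) ≡ f i
    extend-toℕ f zero    = ≡.refl
    extend-toℕ f (suc i) = extend-toℕ (f ∘ suc) i

    extend-≥ : ∀ {n} (f : Vector Carrier n) i → n ≤ i → extend f i ≈ 0#
    extend-≥ {zero}  f i le = refl
    extend-≥ {suc n} f (suc i) (s≤s le) = extend-≥ (f ∘ suc) i le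

    extend-P : ∀ {n} (P : ℕ → Pred Carrier ℓ) → (∀ i → P i 0#) → (f : Vector Carrier n) →
               (∀ i → P (toℕ i) (f i)) → ∀ i → P i (extend f i)
    extend-P {zero}  P P0 f Pf i = P0 i
    extend-P {suc n} P P0 f Pf zero = Pf zero
    extend-P {suc n} P P0 f Pf (suc i) = extend-P (P ∘ suc) (P0 ∘ suc) (f ∘ suc) (Pf ∘ suc) i

    Σ<-extend : ∀ {n} (f : Vector Carrier n) → Σ< n (extend f) ≈ sum f
    Σ<-extend f = sum-cong-≋ λ i → reflexive (extend-toℕ f i)

    -- The homogeneous components of an element of J lie in J.
    components∈ : ∀ {J} → IsSubspace vectorSpace J →
      (∀ {a} → a ∈ J → a ∈ Span vectorSpace (Homogeneous ∩ J)) →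
      ∀ {n} (f : Vector Carrier n) → (∀ i → f i ∈ Deg (toℕ i)) → sum f ∈ J → ∀ i → f i ∈ J
    components∈ {J} Jsub hom {n} f f∈ s∈J i with collect Jsub (hom s∈J)
    ... | m , g , g∈ , gz , eg = IsSubspace.resp Jsub (sym fi≈gi) (proj₂ (g∈ (toℕ i)))
      where
      N = n ⊔ m
      h : ℕ → Carrier
      h j = extend f j + - g j
      split : ∀ {N} (u v : Vector Carrier N) → sum (λ j → u j + - v j) ≈ sum u + - sum v
      split {N} u v = trans (∑-distrib-+ u (λ j → - v j)) (+-cong refl
        (trans (sum-cong-≋ (λ j → sym (neg≈ (v j)))) (trans (sym (sum-· _ {N} v)) (neg≈ _))))
      Σh≈0 : Σ< N h ≈ 0#
      Σh≈0 = trans (split {N} (extend f ∘ toℕ) (g ∘ toℕ)) (x≈y⇒x-y≈0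
        (trans (sym (Σ<-pad (extend f) (extend-≥ f) (m≤m⊔n n m)))
        (trans (Σ<-extend f) (trans eg (Σ<-pad g gz (m≤n⊔m n m))))))
      h∈ : ∀ j → h j ∈ Deg j
      h∈ j = DegS.+∈ j (extend-P Deg DegS.0∈ f f∈ j) (neg∈ (Deg-isSubspace j) (proj₁ (g∈ j)))
      hz : ∀ j → j < N → h j ≈ 0#
      hz j j<N = ≡.subst (λ j → h j ≈ 0#) (toℕ-fromℕ< j<N)
        (independent {N} (h ∘ toℕ) (λ j → h∈ (toℕ j)) Σh≈0 (fromℕ< j<N))
      fi≈gi : f i ≈ g (toℕ i)
      fi≈gi = trans (sym (reflexive (extend-toℕ f i)))
        (x-y≈0⇒x≈y (hz (toℕ i) (ℕₚ.<-≤-trans (toℕ<n i) (m≤m⊔n n m))))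

    module _ (R : Pred Carrier ℓ) where
      ⟨⟩-isSubspace : IsSubspace vectorSpace (⟨_⟩ A R)
      ⟨⟩-isSubspace = record { resp = resp ; 0∈ = zer ; +∈ = add
                             ; ·∈ = λ r p → resp (·1* r _) (mulˡ (r · 1#) p) }

      module _ (R⊆H : R ⊆ Homogeneous) where
        private
          S = Span vectorSpace (Homogeneous ∩ ⟨_⟩ A R)
          module S = IsSubspace (Span-isSubspace (Homogeneous ∩ ⟨_⟩ A R))

        S-mulˡ : ∀ {b x} → b ∈ Span vectorSpace Homogeneous → x ∈ S → b * x ∈ S
        S-mulˡ (base (m , b∈)) (base ((n , x∈) , x∈J)) = base ((m ℕ.+ n , *∈Deg b∈ x∈) , mulˡ _ x∈J)
        S-mulˡ p@(base _) zer = resp (sym (zeroʳ _)) zer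
        S-mulˡ p@(base _) (add x y) = resp (sym (distribˡ _ _ _)) (add (S-mulˡ p x) (S-mulˡ p y))
        S-mulˡ p@(base _) (scal r x) = resp (sym (·-*-assocʳ r _ _)) (scal r (S-mulˡ p x))
        S-mulˡ p@(base _) (resp e x) = resp (*-cong refl e) (S-mulˡ p x)
        S-mulˡ zer x = resp (sym (zeroˡ _)) zer
        S-mulˡ (add p q) x = resp (sym (distribʳ _ _ _)) (add (S-mulˡ p x) (S-mulˡ q x))
        S-mulˡ (scal r p) x = resp (sym (·-*-assocˡ r _ _)) (scal r (S-mulˡ p x))
        S-mulˡ (resp e p) x = resp (*-cong e refl) (S-mulˡ p x)

        S-mulʳ : ∀ {b x} → b ∈ Span vectorSpace Homogeneous → x ∈ S → x * b ∈ S
        S-mulʳ (base (m , b∈)) (base ((n , x∈) , x∈J)) = base ((n ℕ.+ m , *∈Deg x∈ b∈) , mulʳ _ x∈J)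
        S-mulʳ p@(base _) zer = resp (sym (zeroˡ _)) zer
        S-mulʳ p@(base _) (add x y) = resp (sym (distribʳ _ _ _)) (add (S-mulʳ p x) (S-mulʳ p y))
        S-mulʳ p@(base _) (scal r x) = resp (sym (·-*-assocˡ r _ _)) (scal r (S-mulʳ p x))
        S-mulʳ p@(base _) (resp e x) = resp (*-cong e refl) (S-mulʳ p x)
        S-mulʳ zer x = resp (sym (zeroʳ _)) zer
        S-mulʳ (add p q) x = resp (sym (distribˡ _ _ _)) (add (S-mulʳ p x) (S-mulʳ q x))
        S-mulʳ (scal r p) x = resp (sym (·-*-assocʳ r _ _)) (scal r (S-mulʳ p x))
        S-mulʳ (resp e p) x = resp (*-cong refl e) (S-mulʳ p x)

        ⟨⟩⊆S : ⟨_⟩ A R ⊆ S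
        ⟨⟩⊆S (incl r)   = base (R⊆H r , incl r)
        ⟨⟩⊆S zer        = zer
        ⟨⟩⊆S (add p q)  = add (⟨⟩⊆S p) (⟨⟩⊆S q)
        ⟨⟩⊆S (mulˡ a p) = S-mulˡ (spanning a) (⟨⟩⊆S p)
        ⟨⟩⊆S (mulʳ a p) = S-mulʳ (spanning a) (⟨⟩⊆S p)
        ⟨⟩⊆S (resp e p) = resp e (⟨⟩⊆S p)

  ⟨⟩-isHomogeneousIdeal : ∀ A {R : Pred (GradedAlgebra.Carrier A) ℓ} →
                          R ⊆ GradedAlgebra.Homogeneous A → IsHomogeneousIdeal A (⟨_⟩ A R)
  ⟨⟩-isHomogeneousIdeal A {R} R⊆H = record
    { isSubspace = ⟨⟩-isSubspace R ; *-closedˡ = mulˡ ; *-closedʳ = mulʳ ; homogeneous = ⟨⟩⊆S R R⊆H }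
    where open GradedLemmas A

  Quotient : (A : GradedAlgebra) {J : Pred (GradedAlgebra.Carrier A) ℓ} →
             IsHomogeneousIdeal A J → GradedAlgebra
  Quotient A {J} isIdeal = record
    { algebra        = AlgebraLaws.algebra laws
    ; Deg            = Deg/
    ; Deg-isSubspace = λ n → record
      { resp = λ { e (b , b∈ , p) → b , b∈ , ~-trans (~-sym e) p }
      ; 0∈   = 0# , DegS.0∈ n , ~-refl
      ; +∈   = λ { (b , b∈ , p) (c , c∈ , q) → b + c , DegS.+∈ n b∈ c∈ , ~-+ p q }
      ; ·∈   = λ { r (b , b∈ , p) → r · b , DegS.·∈ n r b∈ , ~-· r p } }
    ; 1∈Deg          = 1# , 1∈Deg , ~-refl
    ; *∈Deg          = λ { (b , b∈ , p) (c , c∈ , q) → b * c , *∈Deg b∈ c∈ , ~-* p q }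
    ; spanning       = λ a → project (spanning a)
    ; independent    = λ {n} f f∈ s≈0 →
        let b    = λ i → proj₁ (f∈ i)
            b∈   = λ i → proj₁ (proj₂ (f∈ i))
            f~b  = λ i → proj₂ (proj₂ (f∈ i))
            Σb∈J = J.resp (trans (+-cong refl -0≈0) (LeftModule.+ᴹ-identityʳ vectorSpace _))
                     (~-trans (~-sym (~-sum f b f~b)) s≈0)
        in λ i → ~-trans (f~b i) (J.resp
             (sym (trans (+-cong refl -0≈0) (LeftModule.+ᴹ-identityʳ vectorSpace _)))
             (components∈ I.isSubspace I.homogeneous b b∈ Σb∈J i)) }
    where
    open GradedLemmas A
    module I = IsHomogeneousIdeal isIdeal
    module J = IsSubspace I.isSubspace

    infix 4 _~_
    _~_ : Rel Carrier ℓ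
    a ~ b = a + - b ∈ J

    ≈⇒~ : ∀ {a b} → a ≈ b → a ~ b
    ≈⇒~ e = J.resp (sym (x≈y⇒x-y≈0 e)) J.0∈

    ~-refl : ∀ {a} → a ~ a
    ~-refl = ≈⇒~ refl

    -0≈0 : - 0# ≈ 0#
    -0≈0 = trans (sym (neg≈ 0#)) (·-zeroʳ _)

    -- x ~ y whenever x - y is written as an explicit element of J.
    by : ∀ {x y z} → x ≈ z + y → z ∈ J → x ~ y
    by {x} {y} {z} e z∈ = J.resp (sym (trans (+-cong e refl) (trans (+-assoc z y (- y))
      (trans (+-cong refl (-‿inverseʳ y)) (LeftModule.+ᴹ-identityʳ vectorSpace z))))) z∈

    unby : ∀ x y → x ≈ (x + - y) + y
    unby x y = sym (trans (+-assoc x (- y) y)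
      (trans (+-cong refl (-‿inverseˡ y)) (LeftModule.+ᴹ-identityʳ vectorSpace x)))

    ~-sym : ∀ {a b} → a ~ b → b ~ a
    ~-sym {a} {b} p = by (trans (sym (+-identityˡ b)) (trans (+-cong (sym (-‿inverseˡ (a + - b))) refl)
      (trans (+-assoc _ _ b) (+-cong refl (sym (unby a b)))))) (neg∈ I.isSubspace p)

    ~-trans : ∀ {a b c} → a ~ b → b ~ c → a ~ c
    ~-trans {a} {b} {c} p q = by (trans (unby a b) (trans (+-cong refl (unby b c))
      (sym (+-assoc _ _ c)))) (J.+∈ p q)

    ~-+ : ∀ {a a′ b b′} → a ~ a′ → b ~ b′ → a + b ~ a′ + b′
    ~-+ {a} {a′} {b} {b′} p q =
      by (trans (+-cong (unby a a′) (unby b b′)) (interchange _ a′ _ b′)) (J.+∈ p q)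

    ~-· : ∀ r {a b} → a ~ b → r · a ~ r · b
    ~-· r {a} {b} p = by (trans (·-cong K.refl (unby a b)) (·-distribˡ r _ b)) (J.·∈ r p)

    ~-* : ∀ {a a′ b b′} → a ~ a′ → b ~ b′ → a * b ~ a′ * b′
    ~-* {a} {a′} {b} {b′} p q = ~-trans
      (by (trans (*-cong (unby a a′) refl) (distribʳ b _ a′)) (I.*-closedʳ b p))
      (by (trans (*-cong refl (unby b b′)) (distribˡ a′ _ b′)) (I.*-closedˡ a′ q))

    ~-sum : ∀ {n} (f g : Vector Carrier n) → (∀ i → f i ~ g i) → sum f ~ sum g
    ~-sum {zero}  f g p = ~-refl
    ~-sum {suc n} f g p = ~-+ (p zero) (~-sum (f ∘ suc) (g ∘ suc) (p ∘ suc))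

    laws : AlgebraLaws
    laws = record
      { Carrier = Carrier ; _≈_ = _~_ ; _+_ = _+_ ; _*_ = _*_ ; -_ = -_ ; 0# = 0# ; 1# = 1# ; _·_ = _·_
      ; isEquivalence = record { refl = ~-refl ; sym = ~-sym ; trans = ~-trans }
      ; +-cong = ~-+
      ; +-assoc = λ a b c → ≈⇒~ (+-assoc a b c)
      ; +-comm = λ a b → ≈⇒~ (+-comm a b)
      ; +-identityˡ = λ a → ≈⇒~ (+-identityˡ a)
      ; -‿cong = λ p → ~-trans (≈⇒~ (sym (neg≈ _))) (~-trans (~-· _ p) (≈⇒~ (neg≈ _)))
      ; -‿inverseˡ = λ a → ≈⇒~ (-‿inverseˡ a)
      ; *-cong = ~-*
      ; *-assoc = λ a b c → ≈⇒~ (*-assoc a b c)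
      ; *-identityˡ = λ a → ≈⇒~ (*-identityˡ a)
      ; *-identityʳ = λ a → ≈⇒~ (*-identityʳ a)
      ; distribˡ = λ a b c → ≈⇒~ (distribˡ a b c)
      ; distribʳ = λ a b c → ≈⇒~ (distribʳ a b c)
      ; ·-cong = λ {r} e p → ~-trans (~-· r p) (≈⇒~ (·-cong e refl))
      ; ·-distribˡ = λ r a b → ≈⇒~ (·-distribˡ r a b)
      ; ·-distribʳ = λ a r s → ≈⇒~ (·-distribʳ a r s)
      ; ·-assoc = λ r s a → ≈⇒~ (·-assoc r s a)
      ; ·-identityˡ = λ a → ≈⇒~ (·-identityˡ a)
      ; ·-*-assocˡ = λ r a b → ≈⇒~ (·-*-assocˡ r a b)
      ; ·-*-assocʳ = λ r a b → ≈⇒~ (·-*-assocʳ r a b) }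

    Deg/ : ℕ → Pred Carrier ℓ
    Deg/ n a = ∃[ b ] b ∈ Deg n × a ~ b

    project : ∀ {a} → a ∈ Span vectorSpace Homogeneous →
              a ∈ Span (Algebra.vectorSpace (AlgebraLaws.algebra laws)) (λ a → ∃[ n ] a ∈ Deg/ n)
    project (base (n , a∈)) = base (n , _ , a∈ , ~-refl)
    project zer             = zer
    project (add p q)       = add (project p) (project q)
    project (scal r p)      = scal r (project p)
    project (resp e p)      = resp (≈⇒~ e) (project p)

  -- The tensor algebra T(V) = ⊕ₙ V^⊗n: formal linear combinations of words
  -- v₁ ⊗ ⋯ ⊗ vₙ, modulo linearity of a word in each of its letters.

  data Tensor (V : VectorSpace) : Set ℓ where
    word : List (LeftModule.Carrierᴹ V) → Tensor V
    zer  : Tensor V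
    add  : Tensor V → Tensor V → Tensor V
    neg  : Tensor V → Tensor V
    scal : K.Carrier → Tensor V → Tensor V

  module _ (V : VectorSpace) where
    open LeftModule V

    data TensorEq : Rel (Tensor V) ℓ where
      ≈refl  : ∀ {a} → TensorEq a a
      ≈sym   : ∀ {a b} → TensorEq a b → TensorEq b a
      ≈trans : ∀ {a b c} → TensorEq a b → TensorEq b c → TensorEq a c
      add-cong  : ∀ {a a′ b b′} → TensorEq a a′ → TensorEq b b′ → TensorEq (add a b) (add a′ b′)
      neg-cong  : ∀ {a a′} → TensorEq a a′ → TensorEq (neg a) (neg a′)
      scal-cong : ∀ {r s a b} → r K.≈ s → TensorEq a b → TensorEq (scal r a) (scal s b)
      add-assoc    : ∀ a b c → TensorEq (add (add a b) c) (add a (add b c))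
      add-comm     : ∀ a b → TensorEq (add a b) (add b a)
      add-zer      : ∀ a → TensorEq (add zer a) a
      add-neg      : ∀ a → TensorEq (add (neg a) a) zer
      scal-distribˡ : ∀ r a b → TensorEq (scal r (add a b)) (add (scal r a) (scal r b))
      scal-distribʳ : ∀ a r s → TensorEq (scal (r K.+ s) a) (add (scal r a) (scal s a))
      scal-assoc    : ∀ r s a → TensorEq (scal (r K.* s) a) (scal r (scal s a))
      scal-1        : ∀ a → TensorEq (scal K.1# a) a
      letter-cong : ∀ u {x y} w → x ≈ᴹ y → TensorEq (word (u ++ x ∷ w)) (word (u ++ y ∷ w))
      letter-add  : ∀ u x y w → TensorEq (word (u ++ (x +ᴹ y) ∷ w))
                                         (add (word (u ++ x ∷ w)) (word (u ++ y ∷ w)))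
      letter-scal : ∀ u r x w → TensorEq (word (u ++ (r *ₗ x) ∷ w)) (scal r (word (u ++ x ∷ w)))

    prepend : List Carrierᴹ → Tensor V → Tensor V
    prepend u (word w)   = word (u ++ w)
    prepend u zer        = zer
    prepend u (add a b)  = add (prepend u a) (prepend u b)
    prepend u (neg a)    = neg (prepend u a)
    prepend u (scal r a) = scal r (prepend u a)

    -- Bilinear extension of concatenation of words.
    tmul : Tensor V → Tensor V → Tensor V
    tmul (word u)   b = prepend u b
    tmul zer        b = zer
    tmul (add a c)  b = add (tmul a b) (tmul c b)
    tmul (neg a)    b = neg (tmul a b)
    tmul (scal r a) b = scal r (tmul a b)

    private
      infix 4 _≈_
      _≈_ = TensorEq

      ≡⇒≈ : ∀ {a b} → a ≡ b → a ≈ b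
      ≡⇒≈ ≡.refl = ≈refl

      add-zerʳ : ∀ a → add a zer ≈ a
      add-zerʳ a = ≈trans (add-comm a zer) (add-zer a)

      add-interchange : ∀ a b c d → add (add a b) (add c d) ≈ add (add a c) (add b d)
      add-interchange a b c d = ≈trans (add-assoc a b _) (≈trans (add-cong ≈refl
        (≈trans (≈sym (add-assoc b c d)) (≈trans (add-cong (add-comm b c) ≈refl) (add-assoc c b d))))
        (≈sym (add-assoc a c _)))

      unique-neg : ∀ {a b} → add a b ≈ zer → a ≈ neg b
      unique-neg {a} {b} p = ≈trans (≈sym (add-zerʳ a)) (≈trans
        (add-cong ≈refl (≈sym (≈trans (add-comm b (neg b)) (add-neg b))))
        (≈trans (≈sym (add-assoc a b (neg b))) (≈trans (add-cong p ≈refl) (add-zer _))))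

      idem⇒zer : ∀ {a} → add a a ≈ a → a ≈ zer
      idem⇒zer {a} p = ≈trans (≈sym (add-zer a)) (≈trans (add-cong (≈sym (add-neg a)) ≈refl)
        (≈trans (add-assoc _ a a) (≈trans (add-cong ≈refl p) (add-neg a))))

      scal-zer : ∀ r → scal r zer ≈ zer
      scal-zer r = idem⇒zer (≈trans (≈sym (scal-distribˡ r zer zer)) (scal-cong K.refl (add-zer zer)))

      neg-zer : neg zer ≈ zer
      neg-zer = ≈sym (unique-neg (add-zer zer))

      neg-add : ∀ a b → neg (add a b) ≈ add (neg a) (neg b)
      neg-add a b = ≈sym (unique-neg (≈trans (add-interchange (neg a) (neg b) a b)
        (≈trans (add-cong (add-neg a) (add-neg b)) (add-zer zer))))

      scal-neg : ∀ r a → scal r (neg a) ≈ neg (scal r a)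
      scal-neg r a = unique-neg (≈trans (≈sym (scal-distribˡ r _ a))
        (≈trans (scal-cong K.refl (add-neg a)) (scal-zer r)))

      scal-comm : ∀ r s a → scal r (scal s a) ≈ scal s (scal r a)
      scal-comm r s a = ≈trans (≈sym (scal-assoc r s a))
        (≈trans (scal-cong (K.*-comm r s) ≈refl) (scal-assoc s r a))

      prepend-cong : ∀ u {a b} → a ≈ b → prepend u a ≈ prepend u b
      prepend-cong u ≈refl = ≈refl
      prepend-cong u (≈sym p) = ≈sym (prepend-cong u p)
      prepend-cong u (≈trans p q) = ≈trans (prepend-cong u p) (prepend-cong u q)
      prepend-cong u (add-cong p q) = add-cong (prepend-cong u p) (prepend-cong u q)
      prepend-cong u (neg-cong p) = neg-cong (prepend-cong u p)
      prepend-cong u (scal-cong e p) = scal-cong e (prepend-cong u p)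
      prepend-cong u (add-assoc a b c) = add-assoc _ _ _
      prepend-cong u (add-comm a b) = add-comm _ _
      prepend-cong u (add-zer a) = add-zer _
      prepend-cong u (add-neg a) = add-neg _
      prepend-cong u (scal-distribˡ r a b) = scal-distribˡ r _ _
      prepend-cong u (scal-distribʳ a r s) = scal-distribʳ _ r s
      prepend-cong u (scal-assoc r s a) = scal-assoc r s _
      prepend-cong u (scal-1 a) = scal-1 _
      prepend-cong u (letter-cong v {x} {y} w e)
        rewrite ≡.sym (++-assoc u v (x ∷ w)) | ≡.sym (++-assoc u v (y ∷ w)) = letter-cong (u ++ v) w e
      prepend-cong u (letter-add v x y w)
        rewrite ≡.sym (++-assoc u v ((x +ᴹ y) ∷ w)) | ≡.sym (++-assoc u v (x ∷ w))
              | ≡.sym (++-assoc u v (y ∷ w)) = letter-add (u ++ v) x y w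
      prepend-cong u (letter-scal v r x w)
        rewrite ≡.sym (++-assoc u v ((r *ₗ x) ∷ w)) | ≡.sym (++-assoc u v (x ∷ w)) =
          letter-scal (u ++ v) r x w

      tmul-congʳ : ∀ a {b c} → b ≈ c → tmul a b ≈ tmul a c
      tmul-congʳ (word u)   p = prepend-cong u p
      tmul-congʳ zer        p = ≈refl
      tmul-congʳ (add a b)  p = add-cong (tmul-congʳ a p) (tmul-congʳ b p)
      tmul-congʳ (neg a)    p = neg-cong (tmul-congʳ a p)
      tmul-congʳ (scal r a) p = scal-cong K.refl (tmul-congʳ a p)

      prepend-letter-cong : ∀ u {x y} w → x ≈ᴹ y → ∀ b → prepend (u ++ x ∷ w) b ≈ prepend (u ++ y ∷ w) b
      prepend-letter-cong u {x} {y} w e (word v)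
        rewrite ++-assoc u (x ∷ w) v | ++-assoc u (y ∷ w) v = letter-cong u (w ++ v) e
      prepend-letter-cong u w e zer = ≈refl
      prepend-letter-cong u w e (add a b) = add-cong (prepend-letter-cong u w e a) (prepend-letter-cong u w e b)
      prepend-letter-cong u w e (neg a) = neg-cong (prepend-letter-cong u w e a)
      prepend-letter-cong u w e (scal r a) = scal-cong K.refl (prepend-letter-cong u w e a)

      prepend-letter-add : ∀ u x y w b → prepend (u ++ (x +ᴹ y) ∷ w) b
                           ≈ add (prepend (u ++ x ∷ w) b) (prepend (u ++ y ∷ w) b)
      prepend-letter-add u x y w (word v)
        rewrite ++-assoc u ((x +ᴹ y) ∷ w) v | ++-assoc u (x ∷ w) v | ++-assoc u (y ∷ w) v =
          letter-add u x y (w ++ v)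
      prepend-letter-add u x y w zer = ≈sym (add-zer zer)
      prepend-letter-add u x y w (add a b) = ≈trans
        (add-cong (prepend-letter-add u x y w a) (prepend-letter-add u x y w b))
        (add-interchange _ _ _ _)
      prepend-letter-add u x y w (neg a) = ≈trans (neg-cong (prepend-letter-add u x y w a)) (neg-add _ _)
      prepend-letter-add u x y w (scal r a) =
        ≈trans (scal-cong K.refl (prepend-letter-add u x y w a)) (scal-distribˡ r _ _)

      prepend-letter-scal : ∀ u r x w b → prepend (u ++ (r *ₗ x) ∷ w) b ≈ scal r (prepend (u ++ x ∷ w) b)
      prepend-letter-scal u r x w (word v)
        rewrite ++-assoc u ((r *ₗ x) ∷ w) v | ++-assoc u (x ∷ w) v = letter-scal u r x (w ++ v)
      prepend-letter-scal u r x w zer = ≈sym (scal-zer r)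
      prepend-letter-scal u r x w (add a b) = ≈trans
        (add-cong (prepend-letter-scal u r x w a) (prepend-letter-scal u r x w b))
        (≈sym (scal-distribˡ r _ _))
      prepend-letter-scal u r x w (neg a) =
        ≈trans (neg-cong (prepend-letter-scal u r x w a)) (≈sym (scal-neg r _))
      prepend-letter-scal u r x w (scal s a) =
        ≈trans (scal-cong K.refl (prepend-letter-scal u r x w a)) (scal-comm s r _)

      tmul-congˡ : ∀ b {a c} → a ≈ c → tmul a b ≈ tmul c b
      tmul-congˡ b ≈refl = ≈refl
      tmul-congˡ b (≈sym p) = ≈sym (tmul-congˡ b p)
      tmul-congˡ b (≈trans p q) = ≈trans (tmul-congˡ b p) (tmul-congˡ b q)
      tmul-congˡ b (add-cong p q) = add-cong (tmul-congˡ b p) (tmul-congˡ b q)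
      tmul-congˡ b (neg-cong p) = neg-cong (tmul-congˡ b p)
      tmul-congˡ b (scal-cong e p) = scal-cong e (tmul-congˡ b p)
      tmul-congˡ b (add-assoc _ _ _) = add-assoc _ _ _
      tmul-congˡ b (add-comm _ _) = add-comm _ _
      tmul-congˡ b (add-zer _) = add-zer _
      tmul-congˡ b (add-neg _) = add-neg _
      tmul-congˡ b (scal-distribˡ r _ _) = scal-distribˡ r _ _
      tmul-congˡ b (scal-distribʳ _ r s) = scal-distribʳ _ r s
      tmul-congˡ b (scal-assoc r s _) = scal-assoc r s _
      tmul-congˡ b (scal-1 _) = scal-1 _
      tmul-congˡ b (letter-cong u w e) = prepend-letter-cong u w e b
      tmul-congˡ b (letter-add u x y w) = prepend-letter-add u x y w b
      tmul-congˡ b (letter-scal u r x w) = prepend-letter-scal u r x w b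

      prepend-prepend : ∀ u w c → prepend (u ++ w) c ≡ prepend u (prepend w c)
      prepend-prepend u w (word v) = ≡.cong word (++-assoc u w v)
      prepend-prepend u w zer = ≡.refl
      prepend-prepend u w (add a b) = ≡.cong₂ add (prepend-prepend u w a) (prepend-prepend u w b)
      prepend-prepend u w (neg a) = ≡.cong neg (prepend-prepend u w a)
      prepend-prepend u w (scal r a) = ≡.cong (scal r) (prepend-prepend u w a)

      prepend-mul : ∀ u b c → tmul (prepend u b) c ≡ prepend u (tmul b c)
      prepend-mul u (word w) c = prepend-prepend u w c
      prepend-mul u zer c = ≡.refl
      prepend-mul u (add a b) c = ≡.cong₂ add (prepend-mul u a c) (prepend-mul u b c)
      prepend-mul u (neg a) c = ≡.cong neg (prepend-mul u a c)
      prepend-mul u (scal r a) c = ≡.cong (scal r) (prepend-mul u a c)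

      tmul-assoc : ∀ a b c → tmul (tmul a b) c ≡ tmul a (tmul b c)
      tmul-assoc (word u) b c = prepend-mul u b c
      tmul-assoc zer b c = ≡.refl
      tmul-assoc (add a a′) b c = ≡.cong₂ add (tmul-assoc a b c) (tmul-assoc a′ b c)
      tmul-assoc (neg a) b c = ≡.cong neg (tmul-assoc a b c)
      tmul-assoc (scal r a) b c = ≡.cong (scal r) (tmul-assoc a b c)

      tmul-identityˡ : ∀ a → prepend [] a ≡ a
      tmul-identityˡ (word w) = ≡.refl
      tmul-identityˡ zer = ≡.refl
      tmul-identityˡ (add a b) = ≡.cong₂ add (tmul-identityˡ a) (tmul-identityˡ b)
      tmul-identityˡ (neg a) = ≡.cong neg (tmul-identityˡ a)
      tmul-identityˡ (scal r a) = ≡.cong (scal r) (tmul-identityˡ a)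

      tmul-identityʳ : ∀ a → tmul a (word []) ≡ a
      tmul-identityʳ (word w) = ≡.cong word (++-identityʳ w)
      tmul-identityʳ zer = ≡.refl
      tmul-identityʳ (add a b) = ≡.cong₂ add (tmul-identityʳ a) (tmul-identityʳ b)
      tmul-identityʳ (neg a) = ≡.cong neg (tmul-identityʳ a)
      tmul-identityʳ (scal r a) = ≡.cong (scal r) (tmul-identityʳ a)

      tmul-distribˡ : ∀ a b c → tmul a (add b c) ≈ add (tmul a b) (tmul a c)
      tmul-distribˡ (word u) b c = ≈refl
      tmul-distribˡ zer b c = ≈sym (add-zer zer)
      tmul-distribˡ (add a a′) b c =
        ≈trans (add-cong (tmul-distribˡ a b c) (tmul-distribˡ a′ b c)) (add-interchange _ _ _ _)
      tmul-distribˡ (neg a) b c = ≈trans (neg-cong (tmul-distribˡ a b c)) (neg-add _ _)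
      tmul-distribˡ (scal r a) b c = ≈trans (scal-cong K.refl (tmul-distribˡ a b c)) (scal-distribˡ r _ _)

      tmul-scal : ∀ r a b → tmul a (scal r b) ≈ scal r (tmul a b)
      tmul-scal r (word u) b = ≈refl
      tmul-scal r zer b = ≈sym (scal-zer r)
      tmul-scal r (add a a′) b =
        ≈trans (add-cong (tmul-scal r a b) (tmul-scal r a′ b)) (≈sym (scal-distribˡ r _ _))
      tmul-scal r (neg a) b = ≈trans (neg-cong (tmul-scal r a b)) (≈sym (scal-neg r _))
      tmul-scal r (scal s a) b = ≈trans (scal-cong K.refl (tmul-scal r a b)) (scal-comm s r _)

      laws : AlgebraLaws
      laws = record
        { Carrier = Tensor V ; _≈_ = TensorEq ; _+_ = add ; _*_ = tmul ; -_ = neg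
        ; 0# = zer ; 1# = word [] ; _·_ = scal
        ; isEquivalence = record { refl = ≈refl ; sym = ≈sym ; trans = ≈trans }
        ; +-cong = add-cong ; +-assoc = add-assoc ; +-comm = add-comm ; +-identityˡ = add-zer
        ; -‿cong = neg-cong ; -‿inverseˡ = add-neg
        ; *-cong = λ {a} {a′} {b} {b′} p q → ≈trans (tmul-congˡ b p) (tmul-congʳ a′ q)
        ; *-assoc = λ a b c → ≡⇒≈ (tmul-assoc a b c)
        ; *-identityˡ = λ a → ≡⇒≈ (tmul-identityˡ a)
        ; *-identityʳ = λ a → ≡⇒≈ (tmul-identityʳ a)
        ; distribˡ = tmul-distribˡ
        ; distribʳ = λ a b c → ≈refl
        ; ·-cong = scal-cong ; ·-distribˡ = scal-distribˡ ; ·-distribʳ = scal-distribʳ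
        ; ·-assoc = scal-assoc ; ·-identityˡ = scal-1
        ; ·-*-assocˡ = λ r a b → ≈refl ; ·-*-assocʳ = tmul-scal }

      T : Algebra
      T = AlgebraLaws.algebra laws

      open VectorSpaceLemmas (Algebra.vectorSpace T) using (sum; sum≈0; sum-δ; sum-cong-≋; neg∈; neg≈; Span-isSubspace)

    WordOfLength : ℕ → Pred (Tensor V) ℓ
    WordOfLength n a = ∃[ w ] length w ≡ n × a ≡ word w

    private
      -- Projection onto the words of length n.
      π : ℕ → Tensor V → Tensor V
      π n (word w) with length w ≟ n
      ... | yes _ = word w
      ... | no  _ = zer
      π n zer        = zer
      π n (add a b)  = add (π n a) (π n b)
      π n (neg a)    = neg (π n a)
      π n (scal r a) = scal r (π n a)

      length-slot : ∀ (u : List Carrierᴹ) x y w → length (u ++ x ∷ w) ≡ length (u ++ y ∷ w)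
      length-slot [] x y w = ≡.refl
      length-slot (_ ∷ u) x y w = ≡.cong suc (length-slot u x y w)

      π-yes : ∀ {n} w → length w ≡ n → π n (word w) ≡ word w
      π-yes {n} w e with length w ≟ n
      ... | yes _ = ≡.refl
      ... | no ¬e = ⊥-elim (¬e e)

      π-no : ∀ {n} w → length w ≢ n → π n (word w) ≡ zer
      π-no {n} w ¬e with length w ≟ n
      ... | yes e = ⊥-elim (¬e e)
      ... | no _  = ≡.refl

      π-cong : ∀ n {a b} → a ≈ b → π n a ≈ π n b
      π-cong n ≈refl = ≈refl
      π-cong n (≈sym p) = ≈sym (π-cong n p)
      π-cong n (≈trans p q) = ≈trans (π-cong n p) (π-cong n q)
      π-cong n (add-cong p q) = add-cong (π-cong n p) (π-cong n q)
      π-cong n (neg-cong p) = neg-cong (π-cong n p)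
      π-cong n (scal-cong e p) = scal-cong e (π-cong n p)
      π-cong n (add-assoc _ _ _) = add-assoc _ _ _
      π-cong n (add-comm _ _) = add-comm _ _
      π-cong n (add-zer _) = add-zer _
      π-cong n (add-neg _) = add-neg _
      π-cong n (scal-distribˡ r _ _) = scal-distribˡ r _ _
      π-cong n (scal-distribʳ _ r s) = scal-distribʳ _ r s
      π-cong n (scal-assoc r s _) = scal-assoc r s _
      π-cong n (scal-1 _) = scal-1 _
      π-cong n (letter-cong u {x} {y} w e) with length (u ++ x ∷ w) ≟ n
      ... | yes p rewrite π-yes (u ++ y ∷ w) (≡.trans (length-slot u y x w) p) = letter-cong u w e
      ... | no ¬p rewrite π-no (u ++ y ∷ w) (λ p → ¬p (≡.trans (length-slot u x y w) p)) = ≈refl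
      π-cong n (letter-add u x y w) with length (u ++ (x +ᴹ y) ∷ w) ≟ n
      ... | yes p rewrite π-yes (u ++ x ∷ w) (≡.trans (length-slot u x (x +ᴹ y) w) p)
                        | π-yes (u ++ y ∷ w) (≡.trans (length-slot u y (x +ᴹ y) w) p) = letter-add u x y w
      ... | no ¬p rewrite π-no (u ++ x ∷ w) (λ p → ¬p (≡.trans (length-slot u (x +ᴹ y) x w) p))
                        | π-no (u ++ y ∷ w) (λ p → ¬p (≡.trans (length-slot u (x +ᴹ y) y w) p)) =
                          ≈sym (add-zer zer)
      π-cong n (letter-scal u r x w) with length (u ++ (r *ₗ x) ∷ w) ≟ n
      ... | yes p rewrite π-yes (u ++ x ∷ w) (≡.trans (length-slot u x (r *ₗ x) w) p) = letter-scal u r x w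
      ... | no ¬p rewrite π-no (u ++ x ∷ w) (λ p → ¬p (≡.trans (length-slot u (r *ₗ x) x w) p)) =
                          ≈sym (scal-zer r)

      TDeg : ℕ → Pred (Tensor V) ℓ
      TDeg n = Span (Algebra.vectorSpace T) (WordOfLength n)

      π-fix : ∀ {n a} → a ∈ TDeg n → π n a ≈ a
      π-fix (base (w , e , ≡.refl)) = ≡⇒≈ (π-yes w e)
      π-fix zer = ≈refl
      π-fix (add p q) = add-cong (π-fix p) (π-fix q)
      π-fix (scal r p) = scal-cong K.refl (π-fix p)
      π-fix (resp e p) = ≈trans (π-cong _ (≈sym e)) (≈trans (π-fix p) e)

      π-kill : ∀ {m n a} → m ≢ n → a ∈ TDeg m → π n a ≈ zer
      π-kill m≢n (base (w , e , ≡.refl)) = ≡⇒≈ (π-no w λ p → m≢n (≡.trans (≡.sym e) p))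
      π-kill m≢n zer = ≈refl
      π-kill m≢n (add p q) = ≈trans (add-cong (π-kill m≢n p) (π-kill m≢n q)) (add-zer zer)
      π-kill m≢n (scal r p) = ≈trans (scal-cong K.refl (π-kill m≢n p)) (scal-zer r)
      π-kill m≢n (resp e p) = ≈trans (π-cong _ (≈sym e)) (π-kill m≢n p)

      π-sum : ∀ m {n} (f : Vector (Tensor V) n) → π m (sum f) ≈ sum (π m ∘ f)
      π-sum m {zero}  f = ≈refl
      π-sum m {suc n} f = add-cong ≈refl (π-sum m (f ∘ suc))

      T-independent : ∀ {n} (f : Vector (Tensor V) n) → (∀ i → f i ∈ TDeg (toℕ i)) →
                      sum f ≈ zer → ∀ i → f i ≈ zer
      T-independent f f∈ s≈0 i = ≈trans (≈sym (π-fix (f∈ i))) (≈trans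
        (≈sym (sum-δ (π (toℕ i) ∘ f) i λ j j≢i → π-kill (λ e → j≢i (toℕ-injective e)) (f∈ j)))
        (≈trans (≈sym (π-sum (toℕ i) f)) (π-cong (toℕ i) s≈0)))

      T-* : ∀ {m n a b} → a ∈ TDeg m → b ∈ TDeg n → tmul a b ∈ TDeg (m ℕ.+ n)
      T-* (base (u , e , ≡.refl)) (base (w , e′ , ≡.refl)) =
        base (u ++ w , ≡.trans (length-++ u) (≡.cong₂ ℕ._+_ e e′) , ≡.refl)
      T-* p@(base (u , e , ≡.refl)) zer = zer
      T-* p@(base (u , e , ≡.refl)) (add x y) = add (T-* p x) (T-* p y)
      T-* p@(base (u , e , ≡.refl)) (scal r x) = scal r (T-* p x)
      T-* p@(base (u , e , ≡.refl)) (resp eq x) = resp (prepend-cong u eq) (T-* p x)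
      T-* zer q = zer
      T-* (add p p′) q = add (T-* p q) (T-* p′ q)
      T-* (scal r p) q = scal r (T-* p q)
      T-* (resp eq p) q = resp (tmul-congˡ _ eq) (T-* p q)

      T-spanning : ∀ a → a ∈ Span (Algebra.vectorSpace T) (λ a → ∃[ n ] a ∈ TDeg n)
      T-spanning (word w) = base (length w , base (w , ≡.refl , ≡.refl))
      T-spanning zer = zer
      T-spanning (add a b) = add (T-spanning a) (T-spanning b)
      T-spanning (neg a) = neg∈ (Span-isSubspace _) (T-spanning a)
      T-spanning (scal r a) = scal r (T-spanning a)

    TensorAlgebra : GradedAlgebra
    TensorAlgebra = record
      { algebra        = T
      ; Deg            = TDeg
      ; Deg-isSubspace = λ n → Span-isSubspace (WordOfLength n)
      ; 1∈Deg          = base ([] , ≡.refl , ≡.refl)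
      ; *∈Deg          = T-*
      ; spanning       = T-spanning
      ; independent    = T-independent }

    -- T(V)/⟨R⟩ for R ⊆ V ⊗ V, where V ⊗ V is the degree-2 part of T(V).
    QuadraticPresentation : (R : Pred (Tensor V) ℓ) → R ⊆ GradedAlgebra.Deg TensorAlgebra 2 → GradedAlgebra
    QuadraticPresentation R R⊆ =
      Quotient TensorAlgebra (⟨⟩-isHomogeneousIdeal TensorAlgebra {R} (λ r → 2 , R⊆ r))

  module _ (A : GradedAlgebra) where
    open GradedAlgebra A

    -- A₀ = k, via the unit map r ↦ r · 1.
    IsConnected : Set ℓ
    IsConnected = (∀ {r s} → r · 1# ≈ s · 1# → r K.≈ s)
                × (∀ {a} → a ∈ Deg 0 → ∃[ r ] a ≈ r · 1#)

    data GeneratedBy₁ : Pred Carrier ℓ where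
      base : ∀ {x} → x ∈ Deg 1 → GeneratedBy₁ x
      one  : GeneratedBy₁ 1#
      zer  : GeneratedBy₁ 0#
      add  : ∀ {a b} → GeneratedBy₁ a → GeneratedBy₁ b → GeneratedBy₁ (a + b)
      mul  : ∀ {a b} → GeneratedBy₁ a → GeneratedBy₁ b → GeneratedBy₁ (a * b)
      scal : ∀ r {a} → GeneratedBy₁ a → GeneratedBy₁ (r · a)
      resp : ∀ {a b} → a ≈ b → GeneratedBy₁ a → GeneratedBy₁ b

    IsGeneratedInDegree1 : Set ℓ
    IsGeneratedInDegree1 = ∀ a → a ∈ GeneratedBy₁

    record IsQuadratic : Set (lsuc ℓ) where
      field
        connected           : IsConnected
        generatedInDegree1  : IsGeneratedInDegree1
        relations           : Pred (Tensor (degree 1)) ℓ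
        relations-subspace  : IsSubspace (GradedAlgebra.vectorSpace (TensorAlgebra (degree 1))) relations
        relations-quadratic : relations ⊆ GradedAlgebra.Deg (TensorAlgebra (degree 1)) 2
        presentation        : A ≅ QuadraticPresentation (degree 1) relations relations-quadratic

    IsFiniteType : Set ℓ
    IsFiniteType = FiniteDimensional (degree 1)

    -- Graded left ideals I with I = A I₁.
    record 𝓛 (I : Pred Carrier ℓ) : Set ℓ where
      field
        isSubspace : IsSubspace vectorSpace I
        *-closedˡ  : ∀ a {x} → x ∈ I → a * x ∈ I
        graded     : ∀ {a} → a ∈ I → a ∈ Span vectorSpace (Homogeneous ∩ I)
        generated  : ∀ {a} → a ∈ I →
                     a ∈ Span vectorSpace (λ c → ∃[ b ] ∃[ x ] x ∈ I ∩ Deg 1 × c ≈ b * x)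

    _∶_ : Pred Carrier ℓ → Carrier → Pred Carrier ℓ
    (I ∶ x) a = a * x ∈ I

    IsUniversallyKoszul : Set (lsuc ℓ)
    IsUniversallyKoszul = ∀ I → 𝓛 I → ∀ x → x ∈ Deg 1 → x ∉ I ∩ Deg 1 → 𝓛 (I ∶ x)

  record FilteredSystem (I : FilteredCategory ℓ) : Set (lsuc ℓ) where
    open FilteredCategory I
    field
      alg   : Obj → GradedAlgebra
      trans : ∀ {i j} → i ⇒ j → GradedHom (alg i) (alg j)

    module Alg i = GradedAlgebra (alg i)

    map : ∀ {i j} → i ⇒ j → Alg.Carrier i → Alg.Carrier j
    map f = GradedHom.⟦_⟧ (trans f)

    field
      map-resp-≃ : ∀ {i j} {f g : i ⇒ j} → f ≃ g → ∀ a → Alg._≈_ j (map f a) (map g a)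
      map-id     : ∀ {i} a → Alg._≈_ i (map id a) a
      map-⊚      : ∀ {i j m} (g : j ⇒ m) (f : i ⇒ j) a →
                   Alg._≈_ m (map (g ⊚ f) a) (map g (map f a))

  HasInjectiveTransitions : ∀ {I} → FilteredSystem I → Set ℓ
  HasInjectiveTransitions {I} S = ∀ {i j} (f : i ⇒ j) → Injective (Alg._≈_ i) (Alg._≈_ j) (map f)
    where
    open FilteredCategory I
    open FilteredSystem S

  module ColimitConstruction {I : FilteredCategory ℓ} (S : FilteredSystem I) where
    open FilteredCategory I
    open FilteredSystem S using (alg; map; map-resp-≃; map-id; map-⊚)
    module A i = GradedLemmas (alg i)
    module Φ {i j} (f : i ⇒ j) = GradedHom (FilteredSystem.trans S f)

    ColimitCarrier : Set ℓ
    ColimitCarrier = Σ[ i ∈ Obj ] A.Carrier i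

    -- Elements agree in the colimit when they become equal at a later stage.
    record ColimitEq (x y : ColimitCarrier) : Set ℓ where
      constructor later
      field
        stage : Obj
        left  : proj₁ x ⇒ stage
        right : proj₁ y ⇒ stage
        equal : A._≈_ stage (map left (proj₂ x)) (map right (proj₂ y))

    infix 4 _~_
    _~_ = ColimitEq

    square : ∀ {i j m n} {f : i ⇒ j} {p : j ⇒ n} {g : i ⇒ m} {q : m ⇒ n} → (p ⊚ f) ≃ (q ⊚ g) →
             ∀ a → A._≈_ n (map p (map f a)) (map q (map g a))
    square {n = n} {f} {p} {g} {q} e a =
      A.trans n (A.sym n (map-⊚ p f a)) (A.trans n (map-resp-≃ e a) (map-⊚ q g a))

    -- One pair of arrows p, q makes both the square on i and the square on j commute.
    amalgamate : ∀ {i j m m′} (f : i ⇒ m) (f′ : i ⇒ m′) (g : j ⇒ m) (g′ : j ⇒ m′) →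
      ∃[ n ] Σ[ p ∈ (m ⇒ n) ] Σ[ q ∈ (m′ ⇒ n) ]
        (∀ a → A._≈_ n (map p (map f a)) (map q (map f′ a)))
      × (∀ b → A._≈_ n (map p (map g b)) (map q (map g′ b)))
    amalgamate {i} {j} {m} {m′} f f′ g g′ with upperBound m m′
    ... | n₀ , p₀ , q₀ with coequalize (p₀ ⊚ f) (q₀ ⊚ f′)
    ... | n₁ , h₁ , e₁ with coequalize ((h₁ ⊚ p₀) ⊚ g) ((h₁ ⊚ q₀) ⊚ g′)
    ... | n , h , e = n , h ⊚ (h₁ ⊚ p₀) , h ⊚ (h₁ ⊚ q₀) , left , right
      where
      expand : ∀ {x y} (p : x ⇒ n₀) (f : y ⇒ x) a →
               A._≈_ n (map (h ⊚ (h₁ ⊚ p)) (map f a)) (map h (map h₁ (map (p ⊚ f) a)))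
      expand p f a = A.trans n (map-⊚ h _ _) (Φ.⟦⟧-cong h (A.trans n₁ (map-⊚ h₁ p _)
        (Φ.⟦⟧-cong h₁ (A.sym n₀ (map-⊚ p f a)))))
      left : ∀ a → A._≈_ n (map (h ⊚ (h₁ ⊚ p₀)) (map f a)) (map (h ⊚ (h₁ ⊚ q₀)) (map f′ a))
      left a = A.trans n (expand p₀ f a) (A.trans n (Φ.⟦⟧-cong h (square e₁ a))
        (A.sym n (expand q₀ f′ a)))
      right : ∀ b → A._≈_ n (map (h ⊚ (h₁ ⊚ p₀)) (map g b)) (map (h ⊚ (h₁ ⊚ q₀)) (map g′ b))
      right b = A.trans n (A.trans n (map-⊚ h _ _) (Φ.⟦⟧-cong h (A.sym n₁ (map-⊚ (h₁ ⊚ p₀) g b))))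
        (A.trans n (square e b)
        (A.trans n (Φ.⟦⟧-cong h (map-⊚ (h₁ ⊚ q₀) g′ b)) (A.sym n (map-⊚ h _ _))))

    ~-refl : ∀ {x} → x ~ x
    ~-refl {i , a} = later i id id (A.refl i)

    ~-sym : ∀ {x y} → x ~ y → y ~ x
    ~-sym (later m f g e) = later m g f (A.sym m e)

    ~-trans : ∀ {x y z} → x ~ y → y ~ z → x ~ z
    ~-trans {i , a} {j , b} {l , c} (later m f g e) (later m′ g′ h e′) with amalgamate g g′ g g′
    ... | n , p , q , c₁ , _ = later n (p ⊚ f) (q ⊚ h) (A.trans n (map-⊚ p f a)
      (A.trans n (Φ.⟦⟧-cong p e) (A.trans n (c₁ b) (A.trans n (Φ.⟦⟧-cong q e′) (A.sym n (map-⊚ q h c))))))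

    ι : ∀ i → A.Carrier i → ColimitCarrier
    ι i a = i , a

    ι-cong : ∀ i {a b} → A._≈_ i a b → ι i a ~ ι i b
    ι-cong i e = later i id id (Φ.⟦⟧-cong id e)

    ι-map : ∀ {i j} (f : i ⇒ j) a → ι i a ~ ι j (map f a)
    ι-map {i} {j} f a = later j f id (A.sym j (map-id _))

    module Binary (op : ∀ i → Op₂ (A.Carrier i))
                  (op-cong : ∀ i {a a′ b b′} → A._≈_ i a a′ → A._≈_ i b b′ → A._≈_ i (op i a b) (op i a′ b′))
                  (op-map : ∀ {i j} (f : i ⇒ j) a b → A._≈_ j (map f (op i a b)) (op j (map f a) (map f b)))
                  where

      lifted : Op₂ ColimitCarrier
      lifted (i , a) (j , b) with upperBound i j
      ... | m , f , g = m , op m (map f a) (map g b)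

      -- Any upper bound computes the operation.
      anywhere : ∀ {i j m} (f : i ⇒ m) (g : j ⇒ m) a b →
                 lifted (i , a) (j , b) ~ ι m (op m (map f a) (map g b))
      anywhere {i} {j} {m′} f′ g′ a b with upperBound i j
      ... | m , f , g with amalgamate f f′ g g′
      ... | n , p , q , c₁ , c₂ = later n p q (A.trans n (op-map p _ _)
        (A.trans n (op-cong n (c₁ a) (c₂ b)) (A.sym n (op-map q _ _))))

      lifted-cong : ∀ {x x′ y y′} → x ~ x′ → y ~ y′ → lifted x y ~ lifted x′ y′
      lifted-cong {i , a} {i′ , a′} {j , b} {j′ , b′} (later m f f′ e) (later l g g′ d) with upperBound m l
      ... | n , u , v = ~-trans (anywhere (u ⊚ f) (v ⊚ g) a b) (~-trans
        (ι-cong n (op-cong n (via u e) (via v d)))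
        (~-sym (anywhere (u ⊚ f′) (v ⊚ g′) a′ b′)))
        where
        via : ∀ {x y z} {f : x ⇒ z} {f′ : y ⇒ z} {a a′} (u : z ⇒ n) →
              A._≈_ z (map f a) (map f′ a′) → A._≈_ n (map (u ⊚ f) a) (map (u ⊚ f′) a′)
        via u e = A.trans n (map-⊚ u _ _) (A.trans n (Φ.⟦⟧-cong u e) (A.sym n (map-⊚ u _ _)))

      ι-homo : ∀ m a b → lifted (ι m a) (ι m b) ~ ι m (op m a b)
      ι-homo m a b = ~-trans (anywhere id id a b) (ι-cong m (op-cong m (map-id a) (map-id b)))

    module Add = Binary (λ i → A._+_ i) (λ i → A.+-cong i) (λ f → Φ.+-homo f)
    module Mul = Binary (λ i → A._*_ i) (λ i → A.*-cong i) (λ f → Φ.*-homo f)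

    infixl 6 _+_
    infixl 7 _*_
    infixr 7 _·_
    _+_ = Add.lifted
    _*_ = Mul.lifted

    minus : ColimitCarrier → ColimitCarrier
    minus (i , a) = i , A.-_ i a

    _·_ : K.Carrier → ColimitCarrier → ColimitCarrier
    r · (i , a) = i , A._·_ i r a

    zero# one# : ColimitCarrier
    zero# = inhabited , A.0# inhabited
    one#  = inhabited , A.1# inhabited

    ι-0 : ∀ i → zero# ~ ι i (A.0# i)
    ι-0 i with upperBound inhabited i
    ... | m , f , g = later m f g (A.trans m (Φ.0#-homo f) (A.sym m (Φ.0#-homo g)))

    ι-1 : ∀ i → one# ~ ι i (A.1# i)
    ι-1 i with upperBound inhabited i
    ... | m , f , g = later m f g (A.trans m (Φ.1#-homo f) (A.sym m (Φ.1#-homo g)))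

    minus-cong : ∀ {x y} → x ~ y → minus x ~ minus y
    minus-cong (later m f g e) = later m f g
      (A.trans m (Φ.-‿homo f _) (A.trans m (A.-‿cong m e) (A.sym m (Φ.-‿homo g _))))

    ·-cong : ∀ {r s x y} → r K.≈ s → x ~ y → r · x ~ s · y
    ·-cong r≈s (later m f g e) = later m f g
      (A.trans m (Φ.·-homo f _ _) (A.trans m (A.·-cong m r≈s e) (A.sym m (Φ.·-homo g _ _))))

    infixr 2 _∙_
    _∙_ = ~-trans

    -- Laws of two or three variables are checked at a common stage.
    common₂ : ∀ x y → ∃[ m ] ∃[ a ] ∃[ b ] x ~ ι m a × y ~ ι m b
    common₂ (i , a) (j , b) with upperBound i j
    ... | m , f , g = m , map f a , map g b , ι-map f a , ι-map g b

    common₃ : ∀ x y z → ∃[ m ] ∃[ a ] ∃[ b ] ∃[ c ] x ~ ι m a × y ~ ι m b × z ~ ι m c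
    common₃ x y z with common₂ x y
    ... | m , a , b , p , q with upperBound m (proj₁ z)
    ... | n′ , f , g = n′ , map f a , map f b , map g (proj₂ z)
                     , (p ∙ ι-map f a) , (q ∙ ι-map f b) , ι-map g (proj₂ z)

    plus : ∀ {x y} m {a b} → x ~ ι m a → y ~ ι m b → x + y ~ ι m (A._+_ m a b)
    plus m p q = Add.lifted-cong p q ∙ Add.ι-homo m _ _

    times : ∀ {x y} m {a b} → x ~ ι m a → y ~ ι m b → x * y ~ ι m (A._*_ m a b)
    times m p q = Mul.lifted-cong p q ∙ Mul.ι-homo m _ _

    scale : ∀ r {x} m {a} → x ~ ι m a → r · x ~ ι m (A._·_ m r a)
    scale r m p = ·-cong K.refl p

    infix 1 _at_,_by_
    _at_,_by_ : ∀ {x y} {m} {a b} → x ~ ι m a → (m′ : Obj) → y ~ ι m b → A._≈_ m a b → x ~ y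
    p at m , q by e = p ∙ ι-cong _ e ∙ ~-sym q

    +-assoc : ∀ x y z → (x + y) + z ~ x + (y + z)
    +-assoc x y z with common₃ x y z
    ... | m , a , b , c , p , q , r = plus m (plus m p q) r at m , plus m p (plus m q r) by A.+-assoc m a b c

    +-comm : ∀ x y → x + y ~ y + x
    +-comm x y with common₂ x y
    ... | m , a , b , p , q = plus m p q at m , plus m q p by A.+-comm m a b

    +-identityˡ : ∀ x → zero# + x ~ x
    +-identityˡ (i , a) = plus i (ι-0 i) ~-refl at i , ~-refl by A.+-identityˡ i a

    -‿inverseˡ : ∀ x → minus x + x ~ zero#
    -‿inverseˡ (i , a) = plus i ~-refl ~-refl at i , ι-0 i by A.-‿inverseˡ i a

    *-assoc : ∀ x y z → (x * y) * z ~ x * (y * z)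
    *-assoc x y z with common₃ x y z
    ... | m , a , b , c , p , q , r = times m (times m p q) r at m , times m p (times m q r) by A.*-assoc m a b c

    *-identityˡ : ∀ x → one# * x ~ x
    *-identityˡ (i , a) = times i (ι-1 i) ~-refl at i , ~-refl by A.*-identityˡ i a

    *-identityʳ : ∀ x → x * one# ~ x
    *-identityʳ (i , a) = times i ~-refl (ι-1 i) at i , ~-refl by A.*-identityʳ i a

    distribˡ : ∀ x y z → x * (y + z) ~ x * y + x * z
    distribˡ x y z with common₃ x y z
    ... | m , a , b , c , p , q , r =
      times m p (plus m q r) at m , plus m (times m p q) (times m p r) by A.distribˡ m a b c

    distribʳ : ∀ x y z → (y + z) * x ~ y * x + z * x
    distribʳ x y z with common₃ x y z
    ... | m , a , b , c , p , q , r =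
      times m (plus m q r) p at m , plus m (times m q p) (times m r p) by A.distribʳ m a b c

    ·-distribˡ : ∀ r x y → r · (x + y) ~ r · x + r · y
    ·-distribˡ r x y with common₂ x y
    ... | m , a , b , p , q =
      scale r m (plus m p q) at m , plus m (scale r m p) (scale r m q) by A.·-distribˡ m r a b

    ·-distribʳ : ∀ x r s → (r K.+ s) · x ~ r · x + s · x
    ·-distribʳ (i , a) r s = ~-refl at i , plus i ~-refl ~-refl by A.·-distribʳ i a r s

    ·-*-assocˡ : ∀ r x y → (r · x) * y ~ r · (x * y)
    ·-*-assocˡ r x y with common₂ x y
    ... | m , a , b , p , q =
      times m (scale r m p) q at m , scale r m (times m p q) by A.·-*-assocˡ m r a b

    ·-*-assocʳ : ∀ r x y → x * (r · y) ~ r · (x * y)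
    ·-*-assocʳ r x y with common₂ x y
    ... | m , a , b , p , q =
      times m p (scale r m q) at m , scale r m (times m p q) by A.·-*-assocʳ m r a b

    laws : AlgebraLaws
    laws = record
      { Carrier = ColimitCarrier ; _≈_ = ColimitEq ; _+_ = _+_ ; _*_ = _*_ ; -_ = minus
      ; 0# = zero# ; 1# = one# ; _·_ = _·_
      ; isEquivalence = record { refl = ~-refl ; sym = ~-sym ; trans = ~-trans }
      ; +-cong = Add.lifted-cong ; +-assoc = +-assoc ; +-comm = +-comm ; +-identityˡ = +-identityˡ
      ; -‿cong = minus-cong ; -‿inverseˡ = -‿inverseˡ
      ; *-cong = Mul.lifted-cong ; *-assoc = *-assoc
      ; *-identityˡ = *-identityˡ ; *-identityʳ = *-identityʳ
      ; distribˡ = distribˡ ; distribʳ = distribʳ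
      ; ·-cong = ·-cong ; ·-distribˡ = ·-distribˡ ; ·-distribʳ = ·-distribʳ
      ; ·-assoc = λ { r s (i , a) → ι-cong i (A.·-assoc i r s a) }
      ; ·-identityˡ = λ { (i , a) → ι-cong i (A.·-identityˡ i a) }
      ; ·-*-assocˡ = ·-*-assocˡ ; ·-*-assocʳ = ·-*-assocʳ }

    C : Algebra
    C = AlgebraLaws.algebra laws

    ColimitDeg : ℕ → Pred ColimitCarrier ℓ
    ColimitDeg n x = ∃[ j ] Σ[ b ∈ A.Carrier j ] b ∈ A.Deg j n × ColimitEq x (j , b)

    open VectorSpaceLemmas (Algebra.vectorSpace C) using (sum)

    commonDeg : ∀ {m n} {x y} → x ∈ ColimitDeg m → y ∈ ColimitDeg n →
      ∃[ j ] ∃[ a ] ∃[ b ] a ∈ A.Deg j m × b ∈ A.Deg j n × x ~ ι j a × y ~ ι j b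
    commonDeg (i , a , a∈ , p) (j , b , b∈ , q) with upperBound i j
    ... | m , f , g = m , map f a , map g b , Φ.Deg-homo f a∈ , Φ.Deg-homo g b∈
                    , (p ∙ ι-map f a) , (q ∙ ι-map g b)

    ι-Span : ∀ {i a} → a ∈ Span (A.vectorSpace i) (A.Homogeneous i) →
             ι i a ∈ Span (Algebra.vectorSpace C) (λ x → ∃[ n ] x ∈ ColimitDeg n)
    ι-Span {i} (base (n , a∈)) = base (n , i , _ , a∈ , ~-refl)
    ι-Span {i} zer = resp (ι-0 i) zer
    ι-Span {i} (add p q) = resp (Add.ι-homo i _ _) (add (ι-Span p) (ι-Span q))
    ι-Span {i} (scal r p) = scal r (ι-Span p)
    ι-Span {i} (resp e p) = resp (ι-cong i e) (ι-Span p)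

    map-sum : ∀ {i j} (f : i ⇒ j) {n} (b : Vector (A.Carrier i) n) →
              A._≈_ j (map f (A.sum i b)) (A.sum j (map f ∘ b))
    map-sum {i} {j} f {zero}  b = Φ.0#-homo f
    map-sum {i} {j} f {suc n} b = A.trans j (Φ.+-homo f _ _) (A.+-cong j (A.refl j) (map-sum f (b ∘ suc)))

    ι-sum : ∀ i {n} (b : Vector (A.Carrier i) n) → sum (ι i ∘ b) ~ ι i (A.sum i b)
    ι-sum i {zero}  b = ι-0 i
    ι-sum i {suc n} b = plus i ~-refl (ι-sum i (b ∘ suc))

    sum-cong : ∀ {n} (f g : Vector ColimitCarrier n) → (∀ i → f i ~ g i) → sum f ~ sum g
    sum-cong {zero}  f g p = ~-refl
    sum-cong {suc n} f g p = Add.lifted-cong (p zero) (sum-cong (f ∘ suc) (g ∘ suc) (p ∘ suc))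

    simultaneously : ∀ {n} (d : Fin n → ℕ) (f : Vector ColimitCarrier n) → (∀ l → f l ∈ ColimitDeg (d l)) →
      ∃[ j ] Σ[ b ∈ Vector (A.Carrier j) n ] (∀ l → b l ∈ A.Deg j (d l)) × (∀ l → f l ~ ι j (b l))
    simultaneously {zero} d f f∈ = inhabited , (λ ()) , (λ ()) , (λ ())
    simultaneously {suc n} d f f∈ with simultaneously (d ∘ suc) (f ∘ suc) (f∈ ∘ suc) | f∈ zero
    ... | j , b , b∈ , p | i , a , a∈ , q with upperBound i j
    ... | m , u , v = m
      , (λ { zero → map u a ; (suc l) → map v (b l) })
      , (λ { zero → Φ.Deg-homo u a∈ ; (suc l) → Φ.Deg-homo v (b∈ l) })
      , (λ { zero → q ∙ ι-map u a ; (suc l) → p l ∙ ι-map v (b l) })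

    independent-at : ∀ j {n} (b : Vector (A.Carrier j) n) → (∀ l → b l ∈ A.Deg j (toℕ l)) →
                     ι j (A.sum j b) ~ ι j (A.0# j) → ∀ l → ι j (b l) ~ zero#
    independent-at j b b∈ (later m u v e) l = ι-map u (b l) ∙ ι-cong m
        (A.independent m (map u ∘ b) (λ l → Φ.Deg-homo u (b∈ l))
          (A.trans m (A.sym m (map-sum u b)) (A.trans m e (Φ.0#-homo v))) l)
      ∙ ~-sym (ι-0 m)

    C-independent : ∀ {n} (f : Vector ColimitCarrier n) → (∀ l → f l ∈ ColimitDeg (toℕ l)) →
                    sum f ~ zero# → ∀ l → f l ~ zero#
    C-independent f f∈ s≈0 l with simultaneously toℕ f f∈
    ... | j , b , b∈ , p = p l ∙ independent-at j b b∈
      (~-sym (ι-sum j b) ∙ ~-sym (sum-cong f (ι j ∘ b) p) ∙ s≈0 ∙ ι-0 j) l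

    Colimit : GradedAlgebra
    Colimit = record
      { algebra        = C
      ; Deg            = ColimitDeg
      ; Deg-isSubspace = λ n → record
        { resp = λ { e (j , b , b∈ , p) → j , b , b∈ , (~-sym e ∙ p) }
        ; 0∈   = inhabited , A.0# inhabited , IsSubspace.0∈ (A.Deg-isSubspace inhabited n) , ~-refl
        ; +∈   = λ p q → let (j , a , b , a∈ , b∈ , e , e′) = commonDeg p q in
                   j , A._+_ j a b , IsSubspace.+∈ (A.Deg-isSubspace j n) a∈ b∈ , plus j e e′
        ; ·∈   = λ { r (j , b , b∈ , p) →
                   j , A._·_ j r b , IsSubspace.·∈ (A.Deg-isSubspace j n) r b∈ , scale r j p } }
      ; 1∈Deg          = inhabited , A.1# inhabited , A.1∈Deg inhabited , ~-refl
      ; *∈Deg          = λ p q → let (j , a , b , a∈ , b∈ , e , e′) = commonDeg p q in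
                           j , A._*_ j a b , A.*∈Deg j a∈ b∈ , times j e e′
      ; spanning       = λ { (i , a) → ι-Span (A.spanning i a) }
      ; independent    = C-independent }

    canonicalMap : ∀ i → GradedHom (alg i) Colimit
    canonicalMap i = GradedHomLaws.hom record
      { fun   = ι i
      ; cong  = ι-cong i
      ; plus  = λ a b → ~-sym (Add.ι-homo i a b)
      ; times = λ a b → ~-sym (Mul.ι-homo i a b)
      ; one   = ~-sym (ι-1 i)
      ; scale = λ _ _ → ~-refl
      ; deg   = λ a∈ → i , _ , a∈ , ~-refl }

    IsCocone : (B : GradedAlgebra) → (∀ i → GradedHom (alg i) B) → Set ℓ
    IsCocone B φ = ∀ {i j} (f : i ⇒ j) a →
      GradedAlgebra._≈_ B (GradedHom.⟦_⟧ (φ j) (map f a)) (GradedHom.⟦_⟧ (φ i) a)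

    module _ (B : GradedAlgebra) (φ : ∀ i → GradedHom (alg i) B) (compatible : IsCocone B φ) where
      private
        module B = GradedAlgebra B
        module H i = GradedHom (φ i)

        h : ColimitCarrier → B.Carrier
        h (i , a) = H.⟦_⟧ i a

        h-cong : ∀ {x y} → x ~ y → h x B.≈ h y
        h-cong {i , a} {j , b} (later m f g e) =
          B.trans (B.sym (compatible f a)) (B.trans (H.⟦⟧-cong m e) (compatible g b))

        h-+ : ∀ x y → h (x + y) B.≈ h x B.+ h y
        h-+ (i , a) (j , b) with upperBound i j
        ... | m , f , g = B.trans (H.+-homo m _ _) (B.+-cong (compatible f a) (compatible g b))

        h-* : ∀ x y → h (x * y) B.≈ h x B.* h y
        h-* (i , a) (j , b) with upperBound i j
        ... | m , f , g = B.trans (H.*-homo m _ _) (B.*-cong (compatible f a) (compatible g b))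

      colimitMap : GradedHom Colimit B
      colimitMap = GradedHomLaws.hom record
        { fun   = h
        ; cong  = h-cong
        ; plus  = h-+
        ; times = h-*
        ; one   = H.1#-homo inhabited
        ; scale = λ { r (i , a) → H.·-homo i r a }
        ; deg   = λ { {n} (j , b , b∈ , p) →
                    IsSubspace.resp (B.Deg-isSubspace n) (B.sym (h-cong p)) (H.Deg-homo j b∈) } }

  open ColimitConstruction public
    using (ColimitCarrier; ColimitEq; later; ColimitDeg; Colimit; canonicalMap; IsCocone; colimitMap)

  record GradedSubalgebra (A : GradedAlgebra) : Set (lsuc ℓ) where
    open GradedAlgebra A
    field
      Mem        : Pred Carrier ℓ
      isSubspace : IsSubspace vectorSpace Mem
      1∈         : 1# ∈ Mem
      *∈         : ∀ {a b} → a ∈ Mem → b ∈ Mem → a * b ∈ Mem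
      graded     : ∀ {a} → a ∈ Mem → a ∈ Span vectorSpace (Homogeneous ∩ Mem)

    private
      open GradedLemmas A using (neg∈; Span-least)
      module M = IsSubspace isSubspace

      laws : AlgebraLaws
      laws = record
        { Carrier = ∃ Mem
        ; _≈_ = λ x y → proj₁ x ≈ proj₁ y
        ; _+_ = λ x y → proj₁ x + proj₁ y , M.+∈ (proj₂ x) (proj₂ y)
        ; _*_ = λ x y → proj₁ x * proj₁ y , *∈ (proj₂ x) (proj₂ y)
        ; -_ = λ x → - proj₁ x , neg∈ isSubspace (proj₂ x)
        ; 0# = 0# , M.0∈
        ; 1# = 1# , 1∈
        ; _·_ = λ r x → r · proj₁ x , M.·∈ r (proj₂ x)
        ; isEquivalence = record { refl = refl ; sym = sym ; trans = trans }
        ; +-cong = +-cong ; +-assoc = λ _ _ _ → +-assoc _ _ _ ; +-comm = λ _ _ → +-comm _ _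
        ; +-identityˡ = λ _ → +-identityˡ _
        ; -‿cong = -‿cong ; -‿inverseˡ = λ _ → -‿inverseˡ _
        ; *-cong = *-cong ; *-assoc = λ _ _ _ → *-assoc _ _ _
        ; *-identityˡ = λ _ → *-identityˡ _ ; *-identityʳ = λ _ → *-identityʳ _
        ; distribˡ = λ _ _ _ → distribˡ _ _ _ ; distribʳ = λ _ _ _ → distribʳ _ _ _
        ; ·-cong = ·-cong ; ·-distribˡ = λ r _ _ → ·-distribˡ r _ _
        ; ·-distribʳ = λ _ r s → ·-distribʳ _ r s
        ; ·-assoc = λ r s _ → ·-assoc r s _ ; ·-identityˡ = λ _ → ·-identityˡ _
        ; ·-*-assocˡ = λ r _ _ → ·-*-assocˡ r _ _ ; ·-*-assocʳ = λ r _ _ → ·-*-assocʳ r _ _ }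

      restrict : ∀ {a} → a ∈ Span vectorSpace (Homogeneous ∩ Mem) → (a∈ : a ∈ Mem) →
        (a , a∈) ∈ Span (Algebra.vectorSpace (AlgebraLaws.algebra laws)) (λ x → ∃[ n ] proj₁ x ∈ Deg n)
      restrict (base (h , _)) a∈ = base h
      restrict zer        a∈ = resp refl zer
      restrict (add p q)  a∈ = resp refl (add (restrict p (mem p)) (restrict q (mem q)))
        where mem = Span-least isSubspace proj₂
      restrict (scal r p) a∈ = resp refl (scal r (restrict p (Span-least isSubspace proj₂ p)))
      restrict (resp e p) a∈ = resp e (restrict p (Span-least isSubspace proj₂ p))

      S-sum : ∀ {n} (f : Vector (∃ Mem) n) →
              proj₁ (Algebra.sum (AlgebraLaws.algebra laws) f) ≈ sum (proj₁ ∘ f)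
      S-sum {zero}  f = refl
      S-sum {suc n} f = +-cong refl (S-sum (f ∘ suc))

    subalgebra : GradedAlgebra
    subalgebra = record
      { algebra        = AlgebraLaws.algebra laws
      ; Deg            = λ n x → proj₁ x ∈ Deg n
      ; Deg-isSubspace = λ n → record
        { resp = IsSubspace.resp (Deg-isSubspace n) ; 0∈ = IsSubspace.0∈ (Deg-isSubspace n)
        ; +∈ = IsSubspace.+∈ (Deg-isSubspace n) ; ·∈ = λ r → IsSubspace.·∈ (Deg-isSubspace n) r }
      ; 1∈Deg          = 1∈Deg
      ; *∈Deg          = *∈Deg
      ; spanning       = λ { (a , a∈) → restrict (graded a∈) a∈ }
      ; independent    = λ f f∈ s≈0 → independent (proj₁ ∘ f) f∈ (trans (sym (S-sum f)) s≈0) }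

    inclusion : GradedHom subalgebra A
    inclusion = GradedHomLaws.hom record
      { fun = proj₁ ; cong = λ e → e ; plus = λ _ _ → refl ; times = λ _ _ → refl ; one = refl
      ; scale = λ _ _ → refl ; deg = λ d → d }

  module _ {A : GradedAlgebra} {Index : Set ℓ} (B : Index → GradedSubalgebra A) where
    private
      module A = GradedAlgebra A
      module B i = GradedSubalgebra (B i)

    IsDirected : Set ℓ
    IsDirected = Index × (∀ i j → ∃[ m ] (B.Mem i ⊆ B.Mem m) × (B.Mem j ⊆ B.Mem m))

    module _ (directed : IsDirected) where

      inclusionOrder : FilteredCategory ℓ
      inclusionOrder = record
        { Obj = Index
        ; _⇒_ = λ i j → B.Mem i ⊆ B.Mem j
        ; _≃_ = λ _ _ → Lift ℓ ⊤
        ; id  = λ a∈ → a∈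
        ; _⊚_ = λ g f a∈ → g (f a∈)
        ; ≃-isEquivalence = _
        ; ⊚-cong = _
        ; ⊚-assoc = _
        ; identityˡ = _
        ; identityʳ = _
        ; inhabited = proj₁ directed
        ; upperBound = proj₂ directed
        ; coequalize = λ {i} {j} f g → j , (λ a∈ → a∈) , _ }

      inclusionSystem : FilteredSystem inclusionOrder
      inclusionSystem = record
        { alg = B.subalgebra
        ; trans = λ i⊆j → GradedHomLaws.hom record
          { fun = λ { (a , a∈) → a , i⊆j a∈ } ; cong = λ e → e ; plus = λ _ _ → A.refl
          ; times = λ _ _ → A.refl ; one = A.refl ; scale = λ _ _ → A.refl ; deg = λ d → d }
        ; map-resp-≃ = λ _ _ → A.refl
        ; map-id = λ _ → A.refl
        ; map-⊚ = λ _ _ _ → A.refl }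

      naturalMap : GradedHom (Colimit inclusionSystem) A
      naturalMap = colimitMap inclusionSystem A B.inclusion (λ _ _ → A.refl)

  record IsAsymptoticallyUniversallyKoszul (A : GradedAlgebra) : Set (lsuc ℓ) where
    open GradedAlgebra A
    field
      connected          : IsConnected A
      generatedInDegree1 : IsGeneratedInDegree1 A

      Index    : Set ℓ
      B        : Index → GradedSubalgebra A
      directed : IsDirected B

    module B i = GradedSubalgebra (B i)

    field
      quadratic         : ∀ i → IsQuadratic (B.subalgebra i)
      finiteType        : ∀ i → IsFiniteType (B.subalgebra i)
      universallyKoszul : ∀ i → IsUniversallyKoszul (B.subalgebra i)
      colimit           : IsIsomorphism (naturalMap B directed)
      exhaustive        : ∀ (W : Pred Carrier ℓ) (isSub : IsSubspace vectorSpace W) → W ⊆ Deg 1 →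
                          FiniteDimensional (subspace vectorSpace isSub) →
                          ∃[ i ] W ⊆ (B.Mem i ∩ Deg 1)

{-# OPTIONS --safe #-}

-- Parallel arrows can be coequalized, so injectivity of the transition maps makes the canonical
-- maps Aᵢ → A injective. An injective graded homomorphism reflects degrees: comparing components,
-- every component of a outside degree n is killed by φ once φ(a) has degree n. Hence Aᵢ is
-- isomorphic, as a graded algebra, to its image Bᵢ ⊆ A, to which every hypothesis transports. The
-- images are directed and exhaust A, and a basis of a finite-dimensional W ⊆ A₁ already lies in
-- one of them.
module Submission where

open import Level using () renaming (suc to lsuc)
open import Algebra.Apartness.Bundles using (HeytingField)
open import Algebra.Module.Bundles using (LeftModule)
open import Data.Fin.Base using (suc; toℕ; fromℕ<)
open import Data.Fin.Properties using (toℕ-fromℕ<)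
open import Data.List.Base as List using ([]; _∷_; _++_)
open import Data.List.Properties using (map-++; length-map; ++-assoc)
open import Data.Nat.Base using (ℕ; zero; suc; _≤_; _⊔_)
open import Data.Nat.Properties using (m≤m⊔n; m≤n⊔m)
open import Data.Product.Base using (∃; ∃-syntax; _,_; proj₁; proj₂)
open import Data.Unit.Polymorphic.Base using (⊤)
open import Data.Vec.Functional using (Vector)
open import Function.Base using (_∘_; id)
open import Function.Definitions using (Injective)
open import Relation.Binary.PropositionalEquality as ≡ using (_≡_)
open import Relation.Unary using (Pred; _∈_; _⊆_; _∩_)
open import Defs

module _ {ℓ} {k : HeytingField ℓ ℓ ℓ} where

  -- Linear maps, spans and bases.

  record LinearMap (V W : VectorSpace k) : Set ℓ where
    private
      module V = VectorSpaceLemmas k V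
      module W = VectorSpaceLemmas k W
    field
      fun   : V.Carrierᴹ → W.Carrierᴹ
      cong  : ∀ {x y} → x V.≈ᴹ y → fun x W.≈ᴹ fun y
      plus  : ∀ x y → fun (x V.+ᴹ y) W.≈ᴹ fun x W.+ᴹ fun y
      scale : ∀ r x → fun (r V.*ₗ x) W.≈ᴹ r W.*ₗ fun x

    zero-homo : fun V.0ᴹ W.≈ᴹ W.0ᴹ
    zero-homo = W.identityˡ-unique (fun V.0ᴹ) (fun V.0ᴹ) (W.≈ᴹ-trans (W.≈ᴹ-sym (plus V.0ᴹ V.0ᴹ)) (cong (V.+ᴹ-identityˡ _)))

    sum-homo : ∀ {n} (f : Vector V.Carrierᴹ n) → fun (V.sum f) W.≈ᴹ W.sum (fun ∘ f)
    sum-homo {zero}  f = zero-homo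
    sum-homo {suc n} f = W.≈ᴹ-trans (plus _ _) (W.+ᴹ-cong W.≈ᴹ-refl (sum-homo (f ∘ suc)))

    linearCombination-homo : ∀ {n} (r : Vector (K.Carrier k) n) (b : Vector V.Carrierᴹ n) →
      fun (linearCombination k V r b) W.≈ᴹ linearCombination k W r (fun ∘ b)
    linearCombination-homo {n} r b =
      W.≈ᴹ-trans (sum-homo {n} _) (W.sum-cong-≋ (λ i → scale (r i) (b i)))

    preimage-isSubspace : ∀ {P} → IsSubspace k W P → IsSubspace k V (P ∘ fun)
    preimage-isSubspace isSub = record
      { resp = λ e → P.resp (cong e)
      ; 0∈   = P.resp (W.≈ᴹ-sym zero-homo) P.0∈
      ; +∈   = λ p q → P.resp (W.≈ᴹ-sym (plus _ _)) (P.+∈ p q)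
      ; ·∈   = λ r p → P.resp (W.≈ᴹ-sym (scale r _)) (P.·∈ r p) }
      where module P = IsSubspace isSub

    Span-map : ∀ {P Q} → (∀ {x} → x ∈ P → fun x ∈ Q) → ∀ {x} → x ∈ Span k V P → fun x ∈ Span k W Q
    Span-map {Q = Q} P⊆Q = V.Span-least (preimage-isSubspace (W.Span-isSubspace Q)) (base ∘ P⊆Q)

  module _ {V W : VectorSpace k} (f : LinearMap V W) (g : LinearMap W V) where
    private
      module V = VectorSpaceLemmas k V
      module W = VectorSpaceLemmas k W
      module f = LinearMap f
      module g = LinearMap g

    finiteDimensional-transport : (∀ x → g.fun (f.fun x) V.≈ᴹ x) → (∀ y → f.fun (g.fun y) W.≈ᴹ y) →
                                  FiniteDimensional k V → FiniteDimensional k W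
    finiteDimensional-transport gf fg (n , b , spans , indep) = n , f.fun ∘ b
      , (λ w → let (r , e) = spans (g.fun w) in
           r , W.≈ᴹ-trans (W.≈ᴹ-sym (fg w)) (W.≈ᴹ-trans (f.cong e) (f.linearCombination-homo r b)))
      , (λ r e → indep r (V.≈ᴹ-trans (V.≈ᴹ-sym (gf _))
           (V.≈ᴹ-trans (g.cong (W.≈ᴹ-trans (f.linearCombination-homo r b) e)) g.zero-homo)))

  module _ (V : VectorSpace k) where
    private module V = VectorSpaceLemmas k V

    -- This reduces containment of a finite-dimensional space in a subspace to finitely many
    -- memberships, which a single stage of a filtered system can satisfy.
    spanned⊆ : ∀ {n} {b : Vector V.Carrierᴹ n} → (∀ v → ∃[ r ] v V.≈ᴹ linearCombination k V r b) →
               ∀ {P} → IsSubspace k V P → (∀ l → b l ∈ P) → ∀ v → v ∈ P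
    spanned⊆ {b = b} spans isSub b∈ v = let (r , e) = spans v in
      P.resp (V.≈ᴹ-sym e) (V.sum∈ isSub (λ l → r l V.*ₗ b l) (λ l → P.·∈ (r l) (b∈ l)))
      where module P = IsSubspace isSub

    subspaceInclusion : ∀ {P} (isSub : IsSubspace k V P) → LinearMap (subspace k V isSub) V
    subspaceInclusion _ = record
      { fun = proj₁ ; cong = id ; plus = λ _ _ → V.≈ᴹ-refl ; scale = λ _ _ → V.≈ᴹ-refl }

  -- Graded homomorphisms and their images.

  module _ {A B : GradedAlgebra k} (φ : GradedHom k A B) where
    private
      module A = GradedLemmas k A
      module B = GradedLemmas k B
      open GradedHom φ

    linear : LinearMap A.vectorSpace B.vectorSpace
    linear = record { fun = ⟦_⟧ ; cong = ⟦⟧-cong ; plus = +-homo ; scale = ·-homo }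

    linearOnDegree : ∀ n → LinearMap (A.degree n) (B.degree n)
    linearOnDegree n = record
      { fun = λ (a , a∈) → ⟦ a ⟧ , Deg-homo a∈ ; cong = ⟦⟧-cong
      ; plus = λ _ _ → +-homo _ _ ; scale = λ r _ → ·-homo r _ }

    open LinearMap linear using (Span-map)

    scalar-homo : ∀ r → ⟦ r A.· A.1# ⟧ B.≈ r B.· B.1#
    scalar-homo r = B.trans (·-homo r _) (B.·-cong (K.refl k) 1#-homo)

    GeneratedBy₁-homo : ∀ {a} → a ∈ GeneratedBy₁ k A → ⟦ a ⟧ ∈ GeneratedBy₁ k B
    GeneratedBy₁-homo (base x∈)  = base (Deg-homo x∈)
    GeneratedBy₁-homo one        = resp (B.sym 1#-homo) one
    GeneratedBy₁-homo zer        = resp (B.sym 0#-homo) zer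
    GeneratedBy₁-homo (add p q)  = resp (B.sym (+-homo _ _)) (add (GeneratedBy₁-homo p) (GeneratedBy₁-homo q))
    GeneratedBy₁-homo (mul p q)  = resp (B.sym (*-homo _ _)) (mul (GeneratedBy₁-homo p) (GeneratedBy₁-homo q))
    GeneratedBy₁-homo (scal r p) = resp (B.sym (·-homo r _)) (scal r (GeneratedBy₁-homo p))
    GeneratedBy₁-homo (resp e p) = resp (⟦⟧-cong e) (GeneratedBy₁-homo p)

    ⟨⟩-homo : ∀ {R S} → (∀ {a} → a ∈ R → ⟦ a ⟧ ∈ ⟨_⟩ k B S) → ∀ {a} → a ∈ ⟨_⟩ k A R → ⟦ a ⟧ ∈ ⟨_⟩ k B S
    ⟨⟩-homo R⊆S (incl r)   = R⊆S r
    ⟨⟩-homo R⊆S zer        = resp (B.sym 0#-homo) zer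
    ⟨⟩-homo R⊆S (add p q)  = resp (B.sym (+-homo _ _)) (add (⟨⟩-homo R⊆S p) (⟨⟩-homo R⊆S q))
    ⟨⟩-homo R⊆S (mulˡ a p) = resp (B.sym (*-homo _ _)) (mulˡ _ (⟨⟩-homo R⊆S p))
    ⟨⟩-homo R⊆S (mulʳ a p) = resp (B.sym (*-homo _ _)) (mulʳ _ (⟨⟩-homo R⊆S p))
    ⟨⟩-homo R⊆S (resp e p) = resp (⟦⟧-cong e) (⟨⟩-homo R⊆S p)

    -- Membership stores a preimage as data, so an inverse onto the source can later be read off by
    -- projection.
    image : GradedSubalgebra k B
    image = record
      { Mem        = λ b → ∃[ a ] b B.≈ ⟦ a ⟧
      ; isSubspace = record
        { resp = λ e (a , p) → a , B.trans (B.sym e) p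
        ; 0∈   = A.0# , B.sym 0#-homo
        ; +∈   = λ (a , p) (a′ , p′) → a A.+ a′ , B.trans (B.+-cong p p′) (B.sym (+-homo a a′))
        ; ·∈   = λ r (a , p) → r A.· a , B.trans (B.·-cong (K.refl k) p) (B.sym (·-homo r a)) }
      ; 1∈         = A.1# , B.sym 1#-homo
      ; *∈         = λ (a , p) (a′ , p′) → a A.* a′ , B.trans (B.*-cong p p′) (B.sym (*-homo a a′))
      -- A homogeneous decomposition of the preimage is carried to one of `b` whose terms are again
      -- images.
      ; graded     = λ (a , p) → resp (B.sym p)
          (Span-map (λ {a} (n , a∈) → (n , Deg-homo a∈) , a , B.refl) (A.spanning a)) }

  -- Homogeneous components and injective homomorphisms.

  module _ (A : GradedAlgebra k) where
    open GradedLemmas k A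

    -- Subtracting `b` from the entry of `g` in degree `n` gives a homogeneous family with sum zero;
    -- independence then makes its `n`-th entry `g n - b` vanish.
    homogeneous-component : ∀ {m n b} (g : ℕ → Carrier) → (∀ i → g i ∈ Deg i) → (∀ i → m ≤ i → g i ≈ 0#) →
                            b ∈ Deg n → b ≈ Σ< m g → b ≈ g n
    homogeneous-component {m} {n} {b} g g∈ gz b∈ b≈Σg = sym (x-y≈0⇒x≈y
      (trans (+-cong refl (sym (δ-≡ (- b) n))) h≈0))
      where
      -- The range has to reach past the support of `g` and also contain the index `n`, which may be
      -- at least `m`.
      N = m ⊔ suc n
      h : ℕ → Carrier
      h i = g i + δ (- b) n i
      h∈ : ∀ i → h i ∈ Deg i
      h∈ i = DegS.+∈ i (g∈ i) (δ-P Deg DegS.0∈ (- b) n (neg∈ (Deg-isSubspace n) b∈) i)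
      Σh≈0 : Σ< N h ≈ 0#
      Σh≈0 = trans (∑-distrib-+ {N} _ _) (trans
        (+-cong (trans (sym (Σ<-pad g gz (m≤m⊔n m (suc n)))) (sym b≈Σg))
                (trans (Σ<-δ {N} (δ (- b) n) n (m≤n⊔m m (suc n)) (δ-≢ (- b) n)) (δ-≡ (- b) n)))
        (-‿inverseʳ b))
      h≈0 : h n ≈ 0#
      h≈0 = ≡.subst (λ j → h j ≈ 0#) (toℕ-fromℕ< (m≤n⊔m m (suc n)))
        (independent {N} (h ∘ toℕ) (λ i → h∈ (toℕ i)) Σh≈0 (fromℕ< (m≤n⊔m m (suc n))))

  module _ {A B : GradedAlgebra k} (φ : GradedHom k A B) where
    private
      module A = GradedLemmas k A
      module B = GradedLemmas k B
      open GradedHom φ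
      open LinearMap (linear φ) using (sum-homo)

    module _ (injective : Injective A._≈_ B._≈_ ⟦_⟧) where

      -- If `g` lists the components of `a`, their images are components of `⟦ a ⟧`, so
      -- `⟦ a ⟧ ≈ ⟦ g n ⟧`. Injectivity gives `a ≈ g n`, which has degree `n`.
      reflects-Deg : ∀ {n a} → ⟦ a ⟧ ∈ B.Deg n → a ∈ A.Deg n
      reflects-Deg {n} {a} φa∈ =
        -- `collect` works inside a subspace; here it is the whole of `A`, encoded by the constantly
        -- true predicate.
        let whole = record { resp = λ _ _ → _ ; 0∈ = _ ; +∈ = λ _ _ → _ ; ·∈ = λ _ _ → _ }
            (m , g , g∈ , gz , a≈Σg) = A.collect {J = λ _ → ⊤} whole
              (A.Span-least (A.Span-isSubspace _) (λ h → base (h , _)) (A.spanning a))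
        in A.DegS.resp n
             (A.sym (injective (homogeneous-component B (⟦_⟧ ∘ g) (λ i → Deg-homo (proj₁ (g∈ i)))
               (λ i m≤i → B.trans (⟦⟧-cong (gz i m≤i)) 0#-homo) φa∈
               (B.trans (⟦⟧-cong a≈Σg) (sum-homo {m} _)))))
             (proj₁ (g∈ n))

      -- The inverse returns the stored preimage. Injectivity makes this respect equality, and
      -- `reflects-Deg` makes it preserve degrees.
      image≅ : _≅_ k A (GradedSubalgebra.subalgebra (image φ))
      image≅ = GradedHomLaws.hom record
          { fun = λ a → ⟦ a ⟧ , a , B.refl ; cong = ⟦⟧-cong ; plus = +-homo ; times = *-homo
          ; one = 1#-homo ; scale = ·-homo ; deg = Deg-homo }
        , GradedHomLaws.hom record
          { fun   = λ (_ , a , _) → a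
          ; cong  = λ { {_ , _ , p} {_ , _ , q} e → injective (B.trans (B.sym p) (B.trans e q)) }
          ; plus  = λ _ _ → A.refl
          ; times = λ _ _ → A.refl
          ; one   = A.refl
          ; scale = λ _ _ → A.refl
          ; deg   = λ { {n} {_ , _ , p} b∈ → reflects-Deg (B.DegS.resp n p b∈) } }
        , (λ _ → A.refl)
        , (λ (_ , _ , p) → B.sym p)

  -- Isomorphisms and quotients.

  _∘ᴳ_ : ∀ {A B C : GradedAlgebra k} → GradedHom k B C → GradedHom k A B → GradedHom k A C
  _∘ᴳ_ {C = C} ψ φ = GradedHomLaws.hom record
    { fun   = ψ.⟦_⟧ ∘ φ.⟦_⟧
    ; cong  = ψ.⟦⟧-cong ∘ φ.⟦⟧-cong
    ; plus  = λ _ _ → C.trans (ψ.⟦⟧-cong (φ.+-homo _ _)) (ψ.+-homo _ _)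
    ; times = λ _ _ → C.trans (ψ.⟦⟧-cong (φ.*-homo _ _)) (ψ.*-homo _ _)
    ; one   = C.trans (ψ.⟦⟧-cong φ.1#-homo) ψ.1#-homo
    ; scale = λ r _ → C.trans (ψ.⟦⟧-cong (φ.·-homo r _)) (ψ.·-homo r _)
    ; deg   = ψ.Deg-homo ∘ φ.Deg-homo }
    where
    module C = GradedAlgebra C
    module φ = GradedHom φ
    module ψ = GradedHom ψ

  ≅-sym : ∀ {A B} → _≅_ k A B → _≅_ k B A
  ≅-sym (φ , ψ , ψφ , φψ) = ψ , φ , φψ , ψφ

  ≅-trans : ∀ {A B C} → _≅_ k A B → _≅_ k B C → _≅_ k A C
  ≅-trans {A} {B} {C} (φ , φ⁻ , φ⁻φ , φφ⁻) (ψ , ψ⁻ , ψ⁻ψ , ψψ⁻) = ψ ∘ᴳ φ , φ⁻ ∘ᴳ ψ⁻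
    , (λ a → GradedAlgebra.trans A (GradedHom.⟦⟧-cong φ⁻ (ψ⁻ψ _)) (φ⁻φ a))
    , (λ c → GradedAlgebra.trans C (GradedHom.⟦⟧-cong ψ (φφ⁻ _)) (ψψ⁻ c))

  module _ (A : GradedAlgebra k) {J : Pred (GradedAlgebra.Carrier A) ℓ} (isIdeal : IsHomogeneousIdeal k A J) where
    private module A = GradedLemmas k A

    ≈⇒Quotient≈ : ∀ {a b} → a A.≈ b → GradedAlgebra._≈_ (Quotient k A isIdeal) a b
    ≈⇒Quotient≈ e = IsSubspace.resp J-sub (A.sym (A.x≈y⇒x-y≈0 e)) (IsSubspace.0∈ J-sub)
      where J-sub = IsHomogeneousIdeal.isSubspace isIdeal

  module _ {A B : GradedAlgebra k} (φ : GradedHom k A B)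
           {I} (I-ideal : IsHomogeneousIdeal k A I) {J} (J-ideal : IsHomogeneousIdeal k B J)
           (I⊆J : ∀ {a} → a ∈ I → GradedHom.⟦_⟧ φ a ∈ J) where
    private
      module B = GradedAlgebra B
      module J = IsSubspace (IsHomogeneousIdeal.isSubspace J-ideal)
      open GradedHom φ

      descend : ∀ {a a′} → GradedAlgebra._≈_ (Quotient k A I-ideal) a a′ →
                GradedAlgebra._≈_ (Quotient k B J-ideal) ⟦ a ⟧ ⟦ a′ ⟧
      descend d = J.resp (B.trans (+-homo _ _) (B.+-cong B.refl (-‿homo _))) (I⊆J d)

      ≈⇒~ : ∀ {a b} → a B.≈ b → GradedAlgebra._≈_ (Quotient k B J-ideal) a b
      ≈⇒~ = ≈⇒Quotient≈ B J-ideal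

    -- A quotient keeps the carrier and only coarsens equality, so the induced map is `φ` itself on
    -- representatives.
    quotientHom : GradedHom k (Quotient k A I-ideal) (Quotient k B J-ideal)
    quotientHom = GradedHomLaws.hom record
      { fun   = ⟦_⟧
      ; cong  = descend
      ; plus  = λ _ _ → ≈⇒~ (+-homo _ _)
      ; times = λ _ _ → ≈⇒~ (*-homo _ _)
      ; one   = ≈⇒~ 1#-homo
      ; scale = λ r _ → ≈⇒~ (·-homo r _)
      ; deg   = λ (b , b∈ , d) → ⟦ b ⟧ , Deg-homo b∈ , descend d }

  -- Functoriality of the tensor algebra.

  module _ {V W : VectorSpace k} (f : LinearMap V W) where
    private
      module W = LeftModule W
      open LinearMap f

      _≋_ : Tensor k W → Tensor k W → Set ℓ
      _≋_ = TensorEq k W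

    tensorMap : Tensor k V → Tensor k W
    tensorMap (word w)   = word (List.map fun w)
    tensorMap zer        = zer
    tensorMap (add a b)  = add (tensorMap a) (tensorMap b)
    tensorMap (neg a)    = neg (tensorMap a)
    tensorMap (scal r a) = scal r (tensorMap a)

    tensorMap-cong : ∀ {a b} → TensorEq k V a b → tensorMap a ≋ tensorMap b
    tensorMap-cong ≈refl = ≈refl
    tensorMap-cong (≈sym p) = ≈sym (tensorMap-cong p)
    tensorMap-cong (≈trans p q) = ≈trans (tensorMap-cong p) (tensorMap-cong q)
    tensorMap-cong (add-cong p q) = add-cong (tensorMap-cong p) (tensorMap-cong q)
    tensorMap-cong (neg-cong p) = neg-cong (tensorMap-cong p)
    tensorMap-cong (scal-cong e p) = scal-cong e (tensorMap-cong p)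
    tensorMap-cong (add-assoc _ _ _) = add-assoc _ _ _
    tensorMap-cong (add-comm _ _) = add-comm _ _
    tensorMap-cong (add-zer _) = add-zer _
    tensorMap-cong (add-neg _) = add-neg _
    tensorMap-cong (scal-distribˡ r _ _) = scal-distribˡ r _ _
    tensorMap-cong (scal-distribʳ _ r s) = scal-distribʳ _ r s
    tensorMap-cong (scal-assoc r s _) = scal-assoc r s _
    tensorMap-cong (scal-1 _) = scal-1 _
    -- Distributing the map over the concatenation exposes the distinguished letter, so that the
    -- matching relation in `T(W)` applies. For sums and multiples, linearity of `fun` first
    -- rewrites that letter.
    tensorMap-cong (letter-cong u {x} {y} w e)
      rewrite map-++ fun u (x ∷ w) | map-++ fun u (y ∷ w) = letter-cong (List.map fun u) _ (cong e)
    tensorMap-cong (letter-add u x y w)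
      rewrite map-++ fun u (LeftModule._+ᴹ_ V x y ∷ w) | map-++ fun u (x ∷ w) | map-++ fun u (y ∷ w) =
        ≈trans (letter-cong (List.map fun u) _ (plus x y)) (letter-add (List.map fun u) _ _ _)
    tensorMap-cong (letter-scal u r x w)
      rewrite map-++ fun u (LeftModule._*ₗ_ V r x ∷ w) | map-++ fun u (x ∷ w) =
        ≈trans (letter-cong (List.map fun u) _ (scale r x)) (letter-scal (List.map fun u) r _ _)

    tensorMap-prepend : ∀ u b → tensorMap (prepend k V u b) ≡ prepend k W (List.map fun u) (tensorMap b)
    tensorMap-prepend u (word w)   = ≡.cong word (map-++ fun u w)
    tensorMap-prepend u zer        = ≡.refl
    tensorMap-prepend u (add a b)  = ≡.cong₂ add (tensorMap-prepend u a) (tensorMap-prepend u b)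
    tensorMap-prepend u (neg a)    = ≡.cong neg (tensorMap-prepend u a)
    tensorMap-prepend u (scal r a) = ≡.cong (scal r) (tensorMap-prepend u a)

    tensorMap-tmul : ∀ a b → tensorMap (tmul k V a b) ≡ tmul k W (tensorMap a) (tensorMap b)
    tensorMap-tmul (word u)   b = tensorMap-prepend u b
    tensorMap-tmul zer        b = ≡.refl
    tensorMap-tmul (add a c)  b = ≡.cong₂ add (tensorMap-tmul a b) (tensorMap-tmul c b)
    tensorMap-tmul (neg a)    b = ≡.cong neg (tensorMap-tmul a b)
    tensorMap-tmul (scal r a) b = ≡.cong (scal r) (tensorMap-tmul a b)

    tensorMap-linear : LinearMap (GradedAlgebra.vectorSpace (TensorAlgebra k V))
                                 (GradedAlgebra.vectorSpace (TensorAlgebra k W))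
    tensorMap-linear = record
      { fun = tensorMap ; cong = tensorMap-cong ; plus = λ _ _ → ≈refl ; scale = λ _ _ → ≈refl }

    tensorHom : GradedHom k (TensorAlgebra k V) (TensorAlgebra k W)
    tensorHom = GradedHomLaws.hom record
      { fun   = tensorMap
      ; cong  = tensorMap-cong
      ; plus  = λ _ _ → ≈refl
      ; times = λ a b → GradedAlgebra.reflexive (TensorAlgebra k W) (tensorMap-tmul a b)
      ; one   = ≈refl
      ; scale = λ _ _ → ≈refl
      ; deg   = LinearMap.Span-map tensorMap-linear
                  (λ { (w , e , ≡.refl) → List.map fun w , ≡.trans (length-map fun w) e , ≡.refl }) }

  -- Letters return to themselves only up to the equality of `V`, so each word has to be repaired
  -- letter by letter with `letter-cong`.
  tensorMap-inverse : ∀ {V W : VectorSpace k} (f : LinearMap V W) (g : LinearMap W V) →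
    (∀ x → LeftModule._≈ᴹ_ V (LinearMap.fun g (LinearMap.fun f x)) x) →
    ∀ a → TensorEq k V (tensorMap g (tensorMap f a)) a
  tensorMap-inverse {V} f g gf = inverse
    where
    -- The prefix `u` accumulates the letters already repaired; reassociating `(u ++ x ∷ []) ++ w`
    -- lets the induction move one letter to the right.
    gf-word : ∀ u w → TensorEq k V (word (u ++ List.map (LinearMap.fun g) (List.map (LinearMap.fun f) w))) (word (u ++ w))
    gf-word u []      = ≈refl
    gf-word u (x ∷ w) = ≈trans (letter-cong u _ (gf x))
      (≡.subst₂ (λ v v′ → TensorEq k V (word v) (word v′)) (++-assoc u _ _) (++-assoc u _ _)
        (gf-word (u ++ x ∷ []) w))
    inverse : ∀ a → TensorEq k V (tensorMap g (tensorMap f a)) a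
    inverse (word w)   = gf-word [] w
    inverse zer        = ≈refl
    inverse (add a b)  = add-cong (inverse a) (inverse b)
    inverse (neg a)    = neg-cong (inverse a)
    inverse (scal r a) = scal-cong (K.refl k) (inverse a)

  -- Quadratic presentations over a variable space of generators.

  record Presentation (A : GradedAlgebra k) (V : VectorSpace k) : Set (lsuc ℓ) where
    field
      relations           : Pred (Tensor k V) ℓ
      relations-subspace  : IsSubspace k (GradedAlgebra.vectorSpace (TensorAlgebra k V)) relations
      relations-quadratic : relations ⊆ GradedAlgebra.Deg (TensorAlgebra k V) 2
      presentation        : _≅_ k A (QuadraticPresentation k V relations relations-quadratic)

  -- V is left to unification so that it is the very term in the fields of IsQuadratic: comparing
  -- presentations over spaces that are only definitionally equal unfolds the whole tensor algebra.
  quadratic⇒presentation : ∀ {A} → IsQuadratic k A → Presentation A _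
  quadratic⇒presentation q = record
    { relations = relations ; relations-subspace = relations-subspace
    ; relations-quadratic = relations-quadratic ; presentation = presentation }
    where open IsQuadratic q

  presentation⇒quadratic : ∀ {A} → IsConnected k A → IsGeneratedInDegree1 k A → Presentation A _ →
                           IsQuadratic k A
  presentation⇒quadratic connected generated p = record
    { connected = connected ; generatedInDegree1 = generated
    ; relations = relations ; relations-subspace = relations-subspace
    ; relations-quadratic = relations-quadratic ; presentation = presentation }
    where open Presentation p

  -- The presentation is the composite of `B ≅ A`, `A ≅ T(V)/⟨R⟩` and `T(V)/⟨R⟩ ≅ T(W)/⟨S⟩`, the
  -- last induced by `T(f)` and `T(g)`. Since these are mutually inverse, `S` is the image of `R`
  -- under `T(f)`; writing it as a preimage under `T(g)` makes it a subspace at once.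
  presentation-≅ : ∀ {A B V W} → _≅_ k A B → Presentation A V → (f : LinearMap V W) (g : LinearMap W V) →
    (∀ x → LeftModule._≈ᴹ_ V (LinearMap.fun g (LinearMap.fun f x)) x) →
    (∀ y → LeftModule._≈ᴹ_ W (LinearMap.fun f (LinearMap.fun g y)) y) → Presentation B W
  presentation-≅ {A} {B} {V} {W} iso p f g gf fg = record
    { relations           = S
    ; relations-subspace  = LinearMap.preimage-isSubspace (tensorMap-linear g) R-sub
    ; relations-quadratic = S⊆
    ; presentation        = ≅-trans (≅-sym iso) (≅-trans presentation
        ( quotientHom (tensorHom f) idealV idealW (⟨⟩-homo (tensorHom f)
            (λ r → incl (IsSubspace.resp R-sub (≈sym (tensorMap-inverse f g gf _)) r)))
        , quotientHom (tensorHom g) idealW idealV (⟨⟩-homo (tensorHom g) incl)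
        , (λ a → ≈⇒Quotient≈ (TensorAlgebra k V) idealV (tensorMap-inverse f g gf a))
        , (λ b → ≈⇒Quotient≈ (TensorAlgebra k W) idealW (tensorMap-inverse g f fg b)))) }
    where
    open Presentation p renaming (relations to R; relations-subspace to R-sub; relations-quadratic to R⊆)
    S : Pred (Tensor k W) ℓ
    S = R ∘ tensorMap g
    S⊆ : S ⊆ GradedAlgebra.Deg (TensorAlgebra k W) 2
    -- An element of `S` equals `T(f)` of its image under `T(g)`; that image lies in `R`, hence in
    -- degree 2, and `T(f)` preserves degree.
    S⊆ r = resp (tensorMap-inverse g f fg _) (GradedHom.Deg-homo (tensorHom f) (R⊆ r))
    idealV = ⟨⟩-isHomogeneousIdeal k (TensorAlgebra k V) {R} (λ r → 2 , R⊆ r)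
    idealW = ⟨⟩-isHomogeneousIdeal k (TensorAlgebra k W) {S} (λ s → 2 , S⊆ s)

  -- Transport of the hypotheses along a graded isomorphism.

  module _ {A B : GradedAlgebra k} (iso : _≅_ k A B) where
    private
      module A = GradedAlgebra A
      module B = GradedAlgebra B
      φ  = proj₁ iso
      ψ  = proj₁ (proj₂ iso)
      ψφ = proj₁ (proj₂ (proj₂ iso))
      φψ = proj₂ (proj₂ (proj₂ iso))
      module φ = GradedHom φ
      module ψ = GradedHom ψ

    connected-≅ : IsConnected k A → IsConnected k B
    connected-≅ (inj , scalars) =
        (λ {r} {s} e → inj (A.trans (A.sym (scalar-homo ψ r)) (A.trans (ψ.⟦⟧-cong e) (scalar-homo ψ s))))
      , (λ b∈ → let (r , e) = scalars (ψ.Deg-homo b∈) in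
           r , B.trans (B.sym (φψ _)) (B.trans (φ.⟦⟧-cong e) (scalar-homo φ r)))

    generatedInDegree1-≅ : IsGeneratedInDegree1 k A → IsGeneratedInDegree1 k B
    generatedInDegree1-≅ gen b = resp (φψ b) (GeneratedBy₁-homo φ (gen _))

    quadratic-≅ : IsQuadratic k A → IsQuadratic k B
    quadratic-≅ q = presentation⇒quadratic
      (connected-≅ (IsQuadratic.connected q)) (generatedInDegree1-≅ (IsQuadratic.generatedInDegree1 q))
      (presentation-≅ iso (quadratic⇒presentation q) (linearOnDegree φ 1) (linearOnDegree ψ 1)
        (λ (a , _) → ψφ a) (λ (b , _) → φψ b))

    finiteType-≅ : IsFiniteType k A → IsFiniteType k B
    finiteType-≅ = finiteDimensional-transport (linearOnDegree φ 1) (linearOnDegree ψ 1)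
      (λ (a , _) → ψφ a) (λ (b , _) → φψ b)

    -- The preimage of `I` under `ψ` is its image under `φ`. The preimage form gives the closure
    -- properties; decompositions of `ψ.⟦ b ⟧` pushed forward by `φ` decompose `b`, giving
    -- gradedness and generation in degree 1.
    𝓛-≅ : ∀ {I} → 𝓛 k A I → 𝓛 k B (I ∘ ψ.⟦_⟧)
    𝓛-≅ {I} l = record
      { isSubspace = LinearMap.preimage-isSubspace (linear ψ) L.isSubspace
      ; *-closedˡ  = λ b x∈ → I.resp (A.sym (ψ.*-homo _ _)) (L.*-closedˡ _ x∈)
      ; graded     = λ b∈ → resp (φψ _) (LinearMap.Span-map (linear φ)
          (λ ((n , a∈) , a∈I) → (n , φ.Deg-homo a∈) , pull a∈I) (L.graded b∈))
      ; generated  = λ b∈ → resp (φψ _) (LinearMap.Span-map (linear φ)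
          (λ (b , x , (x∈I , x∈) , e) → φ.⟦ b ⟧ , φ.⟦ x ⟧ , (pull x∈I , φ.Deg-homo x∈)
                                      , B.trans (φ.⟦⟧-cong e) (φ.*-homo _ _))
          (L.generated b∈)) }
      where
      module L = 𝓛 l
      module I = IsSubspace L.isSubspace
      pull : ∀ {a} → a ∈ I → ψ.⟦ φ.⟦ a ⟧ ⟧ ∈ I
      pull = I.resp (A.sym (ψφ _))

  -- Ideals are predicates, so two descriptions of one ideal are related only by mutual inclusion.
  𝓛-resp : ∀ {A : GradedAlgebra k} {I J} → I ⊆ J → J ⊆ I → 𝓛 k A I → 𝓛 k A J
  𝓛-resp {A} I⊆J J⊆I l = record
    { isSubspace = record
      { resp = λ e p → I⊆J (I.resp e (J⊆I p)) ; 0∈ = I⊆J I.0∈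
      ; +∈ = λ p q → I⊆J (I.+∈ (J⊆I p) (J⊆I q)) ; ·∈ = λ r p → I⊆J (I.·∈ r (J⊆I p)) }
    ; *-closedˡ  = λ a p → I⊆J (L.*-closedˡ a (J⊆I p))
    ; graded     = λ p → Span-least (Span-isSubspace _) (λ (h , q) → base (h , I⊆J q)) (L.graded (J⊆I p))
    ; generated  = λ p → Span-least (Span-isSubspace _)
        (λ (b , x , (x∈I , x∈) , e) → base (b , x , (I⊆J x∈I , x∈) , e)) (L.generated (J⊆I p)) }
    where
    open GradedLemmas k A using (Span-least; Span-isSubspace)
    module L = 𝓛 l
    module I = IsSubspace L.isSubspace

  -- Pull `I` back to `A`, take the colon ideal by `ψ.⟦ x ⟧` there, and carry it to `B`. The result
  -- consists of the `b` with `φ(ψ b * ψ x)` in `I`, which is `I ∶ x` because this product equals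
  -- `b * x`.
  universallyKoszul-≅ : ∀ {A B} → _≅_ k A B → IsUniversallyKoszul k A → IsUniversallyKoszul k B
  universallyKoszul-≅ {A} {B} iso@(φ , ψ , ψφ , φψ) uk I l x x∈ x∉ =
    𝓛-resp
      (λ {b} p → I.resp (B.trans (φ.*-homo _ _) (B.*-cong (φψ b) (φψ x))) p)
      (λ {b} p → I.resp (B.sym (B.trans (φ.*-homo _ _) (B.*-cong (φψ b) (φψ x)))) p)
      (𝓛-≅ iso (uk (I ∘ φ.⟦_⟧) (𝓛-≅ (≅-sym iso) l) ψ.⟦ x ⟧ (ψ.Deg-homo x∈)
        (λ (p , _) → x∉ (I.resp (φψ x) p , x∈))))
    where
    module B = GradedAlgebra B
    module φ = GradedHom φ
    module ψ = GradedHom ψ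
    module I = IsSubspace (𝓛.isSubspace l)

  -- The colimit as a directed union of images.

  module _ {I : FilteredCategory ℓ} (A : FilteredSystem k I) where
    open FilteredCategory I using (Obj; inhabited; upperBound; coequalize; _⊚_)
    open FilteredSystem A using (alg; map; map-resp-≃; map-⊚)
    open ColimitConstruction k A using (module A; module Φ; ι; ι-map; _~_; simultaneously)
    private
      module C = GradedAlgebra (Colimit k A)

    -- Equality in the colimit compares `a` and `b` along two possibly different arrows `f` and `g`.
    -- After an arrow `h` equalizing them, both elements are moved by the single transition `h ⊚ f`,
    -- which is injective.
    ι-injective : HasInjectiveTransitions k A → ∀ i → Injective (A._≈_ i) _~_ (ι i)
    ι-injective inj i {a} {b} (later m f g e) =
      let (n , h , hf≃hg) = coequalize f g in
      inj (h ⊚ f) (A.trans n (map-⊚ h f a) (A.trans n (Φ.⟦⟧-cong h e)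
        (A.trans n (A.sym n (map-⊚ h g b)) (A.sym n (map-resp-≃ hf≃hg b)))))

    -- canonicalMap itself ends in a term that is only definitionally equal to Colimit k A, and then
    -- subalgebras of the two are compared by unfolding them.
    toColimit : ∀ i → GradedHom k (alg i) (Colimit k A)
    toColimit = canonicalMap k A

    private module S i = GradedSubalgebra (image (toColimit i))

    alg≅image : HasInjectiveTransitions k A → ∀ i →
                _≅_ k (alg i) (GradedSubalgebra.subalgebra (image (toColimit i)))
    alg≅image inj i = image≅ (toColimit i) (ι-injective inj i)

    -- An arrow out of `i` does not change the class of an element, so it includes the image of
    -- stage `i` in that of its target.
    images-directed : IsDirected k (λ i → image (toColimit i))
    images-directed = inhabited , λ i j → let (m , f , g) = upperBound i j in
        m , (λ (a , p) → map f a , C.trans p (ι-map f a)) , (λ (b , p) → map g b , C.trans p (ι-map g b))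

    -- The representative `(i , a)` of an element of the colimit already names an image containing
    -- it, which defines `lift`. The natural map undoes `lift` on the nose and is injective, so
    -- every law for `lift` follows by applying the natural map to both sides.
    naturalMap-isIsomorphism : IsIsomorphism k (naturalMap k (λ i → image (toColimit i)) images-directed)
    naturalMap-isIsomorphism = GradedHomLaws.hom record
        { fun   = lift
        ; cong  = λ {x} {y} e → injective {lift x} {lift y} e
        ; plus  = λ x y → injective {lift (x C.+ y)} {lift x L.+ lift y} (C.sym (N.+-homo (lift x) (lift y)))
        ; times = λ x y → injective {lift (x C.* y)} {lift x L.* lift y} (C.sym (N.*-homo (lift x) (lift y)))
        ; one   = injective {lift C.1#} {L.1#} (C.sym N.1#-homo)
        ; scale = λ r x → injective {lift (r C.· x)} {r L.· lift x} (C.sym (N.·-homo r (lift x)))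
        ; deg   = λ {_} {x} x∈ → proj₁ x , proj₂ (lift x) , x∈ , L.refl {lift x} }
      , (λ x → injective {lift (N.⟦_⟧ x)} {x} C.refl)
      , (λ _ → C.refl)
      where
      module L = GradedAlgebra (Colimit k (inclusionSystem k (λ i → image (toColimit i)) images-directed))
      module N = GradedHom (naturalMap k (λ i → image (toColimit i)) images-directed)
      lift : C.Carrier → L.Carrier
      lift (i , a) = i , ι i a , a , C.refl
      injective : Injective L._≈_ C._≈_ N.⟦_⟧
      -- The natural map forgets only the index; in an image containing both, the two elements are
      -- compared as elements of the colimit, which is `e`.
      injective {i , _} {j , _} e = let (m , f , g) = proj₂ images-directed i j in later m f g e

    images-exhaustive : ∀ (W : Pred C.Carrier ℓ) (isSub : IsSubspace k C.vectorSpace W) → W ⊆ C.Deg 1 →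
      FiniteDimensional k (subspace k C.vectorSpace isSub) → ∃[ i ] W ⊆ (S.Mem i ∩ C.Deg 1)
    images-exhaustive W isSub W⊆ (n , b , spans , _) =
      -- The finitely many basis vectors all have degree 1, so they have representatives at one
      -- common stage `i`.
      let (i , a , _ , b~a) = simultaneously (λ _ → 1) (proj₁ ∘ b) (λ l → W⊆ (proj₂ (b l)))
      in i , λ {w} w∈ →
           spanned⊆ (subspace k C.vectorSpace isSub) spans
             (LinearMap.preimage-isSubspace (subspaceInclusion C.vectorSpace isSub) (S.isSubspace i))
             (λ l → a l , b~a l) (w , w∈)
         , W⊆ w∈

    -- The unit of the colimit comes from the stage `inhabited`, so an equality of scalars descends
    -- there by injectivity. An element of degree 0 has a representative of degree 0 at some stage,
    -- where it is a scalar.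
    Colimit-connected : HasInjectiveTransitions k A → (∀ i → IsConnected k (alg i)) → IsConnected k (Colimit k A)
    Colimit-connected inj conn =
        (λ e → proj₁ (conn inhabited) (ι-injective inj inhabited e))
      , (λ (j , b , b∈ , x~b) → let (r , e) = proj₂ (conn j) b∈ in
           r , C.trans x~b (C.trans (GradedHom.⟦⟧-cong (toColimit j) e) (scalar-homo (toColimit j) r)))

    Colimit-generatedInDegree1 : (∀ i → IsGeneratedInDegree1 k (alg i)) → IsGeneratedInDegree1 k (Colimit k A)
    Colimit-generatedInDegree1 gen (i , a) = GeneratedBy₁-homo (toColimit i) (gen i a)

proposition3p2 : ∀ {ℓ} (k : HeytingField ℓ ℓ ℓ) (I : FilteredCategory ℓ) (A : FilteredSystem k I) →
    HasInjectiveTransitions k A →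
    (∀ i → IsQuadratic k (FilteredSystem.alg A i)) →
    (∀ i → IsFiniteType k (FilteredSystem.alg A i)) →
    (∀ i → IsUniversallyKoszul k (FilteredSystem.alg A i)) →
    IsAsymptoticallyUniversallyKoszul k (Colimit k A)
proposition3p2 k I A inj quad fin uk = record
  { connected          = Colimit-connected A inj (λ i → IsQuadratic.connected (quad i))
  ; generatedInDegree1 = Colimit-generatedInDegree1 A (λ i → IsQuadratic.generatedInDegree1 (quad i))
  ; Index              = FilteredCategory.Obj I
  ; B                  = λ i → image (toColimit A i)
  ; directed           = images-directed A
  ; quadratic          = λ i → quadratic-≅ (alg≅image A inj i) (quad i)
  ; finiteType         = λ i → finiteType-≅ (alg≅image A inj i) (fin i)
  ; universallyKoszul  = λ i → universallyKoszul-≅ (alg≅image A inj i) (uk i)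
  ; colimit            = naturalMap-isIsomorphism A
  ; exhaustive         = images-exhaustive A }
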